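{- Let $\mathfrak{A}$ be an implicit calculus with downward space $\mathrm{Down}(\mathfrak{A})=(\mathbf{S},\leqslant)$. For every $\mathfrak{B}\in\mathbf{S}$ and every proof $\mathcal{P}$ of a g-sequent $\mathcal{G}$ in $\mathfrak{B}$, there is a proof $\mathcal{P}'$ of $\mathcal{G}$ in $\mathfrak{A}$ that is computable from $\mathcal{P}$ in polynomial time and satisfies $\|\mathcal{P}'\|\leq\|\mathcal{P}\|$.
   Context: Fix a non-empty finite set $\mathtt{E}$ of edge types and a countably infinite set $\mathtt S$ of sequents (atomic labels). A g-sequent $\mathcal G$ is a finite graph with edge relations $\mathcal E_a$ ($a\in\mathtt E$) and vertex labels in $\mathtt S$, written $\Gamma\vdash\Delta$ ($\Gamma$ the edge atoms $w\mathcal E_a u$, $\Delta$ the prefixed sequents $w:S$); size $\|\mathcal G\|=|\Gamma|+|\Delta|$. Let $\overline{\mathtt E}=\{\bar a\mid a\in\mathtt E\}$, $\bar{\bar z}=z$, $\overline{x_1\cdots x_n}=\bar x_n\cdots\bar x_1$. An $\mathtt E$-system is a finite set $\mathbf G$ of production rules $x\longrightarrow t$ ($x\in\mathtt E\cup\overline{\mathtt E}$) with $x\longrightarrow t\in\mathbf G$ iff $\bar x\longrightarrow\bar t\in\mathbf G$; $\mathbf G(a)=\{t\mid a\longrightarrow^*_{\mathbf G}t\}$. For $p=x\longrightarrow t$, $\bar p=\bar x\longrightarrow\bar t$; $(p,\bar p)$ is a production pair; $P(\mathbf G)$ the set of pairs in $\mathbf G$; $\mathbf G(P)$ the set of rules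 in pairs of $P$. Rules: initial rules $i(C,R)$ (no premises) and reachability rules $r(\mathcal C,R)$ (premises $\Gamma\vdash\Delta,w:S_i,u:S'_i$, conclusion $\Gamma\vdash\Delta,w:S,u:S'$), governed by constraints (trees whose edges $(w,u)$ are labelled by languages $\mathbf G'(a)$, $\mathbf G'$ a participating $\mathtt E$-system, requiring a path $w\to u$ labelled by a string of $\mathbf G'(a)$; $(x,y)\in\mathcal E_b$ is traversed forward with $b$, backward with $\bar b$) and sequent constraints $R$; local rules; expansion rules; and Horn rules: for $a\in\mathtt E$ and string $s=x_1\cdots x_n$, forward Horn rule with premise $\Gamma,w\mathcal E_s u,w\mathcal E_a u\vdash\Delta$ and conclusion $\Gamma,w\mathcal E_s u\vdash\Delta$, backward Horn rule with $u\mathcal E_a w$ in place of $w\mathcal E_a u$ ($w\mathcal E_s u$ a chain $w\mathcal E_{x_1}v_1,\dots,v_{n-1}\mathcal E_{x_n}u$, $v\mathcal E_{\bar a}z$ meaning $z\mathcal E_a v$, $w\mathcal E_\varepsilon u$ meaning $w=u$). For a pair with $p=a\longrightarrow s$ (resp. $\bar a\longrightarrow s$), $\mathrm H(p,\bar p)$ is the corresponding forward (resp. backward) Horn rule; $\mathrm H(P)=\bigcup_{(p,\bar p)\in P}\mathrm H(p,\bar p)$. Grammars: $\mathbf G(\rho)$ for initial/reachability $\rho$ is the union of participating $\mathtt E$-systems; $\emptyset$ for local/expansion; $\mathbf G(h_f)=\{a\longrightarrow s,\bar a\longrightarrow\bar s\}$, $\mathbf G(h_b)=\{\bar a\longrightarrow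 s,a\longrightarrow\bar s\}$; unions for sets. Absorb/fracture: $\rho\oplus\mathbf G$ (resp. $\rho\ominus\mathbf G$) replaces each constraint label $\mathbf G'(a)$ by $(\mathbf G'\cup\mathbf G)(a)$ (resp. $(\mathbf G'\setminus\mathbf G)(a)$). An abstract calculus is $\mathfrak A=(\mathcal G^{\mathtt E},\mathfrak R)$ with $\mathfrak R$ finite; $\mathrm H(\mathfrak A)$ its Horn rules; $\mathbf G(\mathfrak A)=\mathbf G(\mathfrak R)$; $\mathfrak A\setminus\mathrm R$, $\mathfrak A\cup\mathrm R$ act on rule sets; $\mathfrak A\ominus\mathbf G$ applies $\ominus\mathbf G$ to each initial and reachability rule. $\mathfrak A$ is implicit iff it contains no Horn rules and every initial and reachability rule $\rho$ of $\mathfrak A$ satisfies $\rho\oplus\mathbf G(\mathfrak A)=\rho$. A proof is a finite tree of rule applications whose leaves are conclusions of initial rules; $\|\mathcal P\|$ is (max size of a g-sequent in $\mathcal P$) times (number of distinct g-sequents in $\mathcal P$). Dependency graph $\mathsf{DG}(\mathbf G)=(P(\mathbf G),\sqsubseteq)$: for distinct pairs with $p=x\longrightarrow s$, $p'=y\longrightarrow t$, $(p,\bar p)\sqsubset(p',\bar p')$ iff $s$ or $\bar s$ contains $y$; $\sqsubseteq$ the reflexive-transitive closure. $V'$ is fracturable iff there are no $v\in V'$, $v'\notin V'$ with $v\sqsubseteq v'$. Downward space $\mathrm{Down}(\mathfrak A)=(\mathbf S,\leqslant)$: $\mathfrak A\in\mathbf S$; if $\mathfrak B\in\mathbf S$,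 $\mathbf G:=\mathbf G(\mathfrak B\setminus\mathrm H(\mathfrak B))$ and $P'\subseteq P(\mathbf G)$ is fracturable in $\mathsf{DG}(\mathbf G)$, then $\mathfrak C=(\mathfrak B\ominus\mathbf G(P'))\cup\mathrm H(P')\in\mathbf S$ and $\mathfrak C\leqslant\mathfrak B$.
   Formalization: Proofs, both given and constructed, must satisfy the eigenvariable condition: the vertex introduced by an expansion rule occurs only in the subproof above that rule application. If it need only be absent from the rule's conclusion, the size bound can fail. -}

module Defs where

open import Data.Fin using (Fin; zero; suc; toℕ)
import Data.Fin.Properties as Fin
open import Data.List using (List; []; _∷_; [_]; _++_; map; concat; concatMap; filter; foldr; length; reverse; deduplicate)
import Data.List as List
open import Data.List.Properties using (map-∘; map-cong; map-id; reverse-map; reverse-involutive; ≡-dec)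
open import Data.List.Membership.Propositional using (_∈_; _∉_)
open import Data.List.Membership.Propositional.Properties using (∈-++⁺ˡ; ∈-++⁺ʳ; ∈-++⁻; ∈-map⁺; ∈-map⁻; ∈-filter⁺; ∈-filter⁻)
import Data.List.Membership.DecPropositional as DecMembership
open import Data.List.Relation.Binary.Disjoint.Propositional using (Disjoint)
import Data.List.Relation.Binary.Subset.DecPropositional as DecSubset
open import Data.List.Relation.Binary.Subset.Propositional using (_⊆_)
open import Data.List.Relation.Unary.All using (All)
open import Data.List.Relation.Unary.Any using (Any; index)
open import Data.List.Relation.Unary.Unique.Propositional using (Unique)
open import Data.Nat using (ℕ; zero; suc; _+_; _*_; _^_; _≤_; _⊔_)
open import Data.Nat.Binary using (ℕᵇ; fromℕ) renaming (zero to 0ᵇ; 2[1+_] to 2[1+_]ᵇ; 1+[2_] to 1+[2_]ᵇ)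
import Data.Nat.Properties as ℕ
open import Data.Product using (∃-syntax; _×_; _,_; proj₁)
open import Data.Product.Properties using () renaming (≡-dec to ×-≡-dec)
open import Data.Sum using (_⊎_; inj₁; inj₂)
open import Data.Unit using (⊤)
open import Data.Vec using (Vec; []; _∷_; lookup; toList; zip)
open import Data.Vec.Relation.Binary.Pointwise.Inductive using (Pointwise)
open import Function using (_∘_)
open import Function.Bundles using (_↔_; _⇔_; mk⇔; Inverse; Equivalence)
open import Function.Properties.Inverse using (↔⇒↣)
import Level
open import Relation.Binary.Construct.Closure.ReflexiveTransitive using (Star)
open import Relation.Binary.Definitions using (DecidableEquality; Decidable)
open import Relation.Binary.PropositionalEquality using (_≡_; _≢_; refl; sym; trans; cong; cong₂; subst)
open import Relation.Nullary using (¬_; Dec; yes; no)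
open import Relation.Nullary.Decidable using (via-injection; _×-dec_; ¬?; map′)

------------------------------------------------------------------------
-- Polynomial time
--
-- The machine model is a first-order functional language on binary trees
-- with call-by-value evaluation.  Every evaluation step costs one unit, and
-- reading a variable costs in addition the size of its value, as if the
-- value were copied.  The size of a result is therefore bounded by the
-- time, and running times agree with those of a Turing machine up to a
-- polynomial.

data Tree : Set where
  leaf : Tree
  node : Tree → Tree → Tree

size : Tree → ℕ
size leaf       = 1
size (node l r) = suc (size l + size r)

-- Expressions over k unary functions, with n variables in scope.
data Exp (k n : ℕ) : Set where
  var   : Fin n → Exp k n
  leaf  : Exp k n
  node  : Exp k n → Exp k n → Exp k n
  match : Exp k n → (ifLeaf : Exp k n) → (ifNode : Exp k (suc (suc n))) → Exp k n
  call  : Fin k → Exp k n → Exp k n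

-- Function zero is the main function; the bodies are mutually recursive.
record Program : Set where
  field
    extra  : ℕ
    bodies : Vec (Exp (suc extra) 1) (suc extra)

-- Γ ⊢[ bs ] e ⇓ v ⟨ t ⟩ : in environment Γ, e evaluates to v in time t.
data _⊢[_]_⇓_⟨_⟩ {k n : ℕ} (Γ : Vec Tree n) (bs : Vec (Exp k 1) k) :
       Exp k n → Tree → ℕ → Set where
  var    : ∀ i → Γ ⊢[ bs ] var i ⇓ lookup Γ i ⟨ suc (size (lookup Γ i)) ⟩
  leaf   : Γ ⊢[ bs ] leaf ⇓ leaf ⟨ 1 ⟩
  node   : ∀ {d e u v s t} →
           Γ ⊢[ bs ] d ⇓ u ⟨ s ⟩ → Γ ⊢[ bs ] e ⇓ v ⟨ t ⟩ →
           Γ ⊢[ bs ] node d e ⇓ node u v ⟨ suc (s + t) ⟩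
  match₀ : ∀ {d e f v s t} →
           Γ ⊢[ bs ] d ⇓ leaf ⟨ s ⟩ → Γ ⊢[ bs ] e ⇓ v ⟨ t ⟩ →
           Γ ⊢[ bs ] match d e f ⇓ v ⟨ suc (s + t) ⟩
  match₁ : ∀ {d e f l r v s t} →
           Γ ⊢[ bs ] d ⇓ node l r ⟨ s ⟩ → (l ∷ r ∷ Γ) ⊢[ bs ] f ⇓ v ⟨ t ⟩ →
           Γ ⊢[ bs ] match d e f ⇓ v ⟨ suc (s + t) ⟩
  call   : ∀ {g e u v s t} →
           Γ ⊢[ bs ] e ⇓ u ⟨ s ⟩ → (u ∷ []) ⊢[ bs ] lookup bs g ⇓ v ⟨ t ⟩ →
           Γ ⊢[ bs ] call g e ⇓ v ⟨ suc (s + t) ⟩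

infix 4 _on_returns_within_
_on_returns_within_ : Program → Tree → Tree → ℕ → Set
p on x returns y within b =
  ∃[ t ] (x ∷ []) ⊢[ Program.bodies p ] lookup (Program.bodies p) zero ⇓ y ⟨ t ⟩ × t ≤ b

-- Sizes are positive, so the bounds c · nᵈ dominate all polynomials in n.
PolyTime : ∀ {a b c} {I : Set a} {X : I → Set b} {Y : I → Set c} →
           (∀ {i} → X i → Tree) → (∀ {i} → Y i → Tree) → (∀ {i} → X i → Y i) → Set (a Level.⊔ b)
PolyTime codeX codeY f =
  ∃[ p ] ∃[ c ] ∃[ d ] (∀ {i} x →
    p on codeX {i} x returns codeY (f x) within c * size (codeX x) ^ d)

codeList : List Tree → Tree
codeList = foldr node leaf

codeℕᵇ : ℕᵇ → Tree
codeℕᵇ 0ᵇ         = leaf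
codeℕᵇ 2[1+ n ]ᵇ  = node leaf (codeℕᵇ n)
codeℕᵇ 1+[2 n ]ᵇ  = node (node leaf leaf) (codeℕᵇ n)

codeℕ : ℕ → Tree
codeℕ = codeℕᵇ ∘ fromℕ

------------------------------------------------------------------------

record Signature : Set₁ where
  field
    E           : Set
    pred∣E∣     : ℕ
    E-finite    : E ↔ Fin (suc pred∣E∣)
    S           : Set
    S-countable : S ↔ ℕ

module Calculi (Sig : Signature) where
  open Signature Sig

  _≟E_ : DecidableEquality E
  _≟E_ = via-injection (↔⇒↣ E-finite) Fin._≟_

  _≟S_ : DecidableEquality S
  _≟S_ = via-injection (↔⇒↣ S-countable) ℕ._≟_

  ----------------------------------------------------------------------
  -- Strings and E-systems

  data Letter : Set where
    fwd bwd : E → Letter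

  String : Set
  String = List Letter

  bar : Letter → Letter
  bar (fwd a) = bwd a
  bar (bwd a) = fwd a

  barˢ : String → String
  barˢ s = reverse (map bar s)

  infix 6 _⟶_
  record Production : Set where
    constructor _⟶_
    field
      lhs : Letter
      rhs : String
  open Production public

  barᵖ : Production → Production
  barᵖ (x ⟶ t) = bar x ⟶ barˢ t

  bar-involutive : ∀ x → bar (bar x) ≡ x
  bar-involutive (fwd a) = refl
  bar-involutive (bwd a) = refl

  barˢ-involutive : ∀ s → barˢ (barˢ s) ≡ s
  barˢ-involutive s =
    trans (cong reverse (reverse-map bar (map bar s)))
    (trans (reverse-involutive (map bar (map bar s)))
    (trans (sym (map-∘ s)) (trans (map-cong bar-involutive s) (map-id s))))

  barᵖ-involutive : ∀ p → barᵖ (barᵖ p) ≡ p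
  barᵖ-involutive (x ⟶ t) = cong₂ _⟶_ (bar-involutive x) (barˢ-involutive t)

  _≟L_ : DecidableEquality Letter
  fwd a ≟L fwd b = map′ (cong fwd) (λ { refl → refl }) (a ≟E b)
  fwd a ≟L bwd b = no λ ()
  bwd a ≟L fwd b = no λ ()
  bwd a ≟L bwd b = map′ (cong bwd) (λ { refl → refl }) (a ≟E b)

  _≟P_ : DecidableEquality Production
  (x ⟶ s) ≟P (y ⟶ t) =
    map′ (λ { (refl , refl) → refl }) (λ { refl → refl , refl }) (x ≟L y ×-dec ≡-dec _≟L_ s t)

  record ESystem : Set where
    field
      rules  : List Production
      closed : ∀ p → p ∈ rules ⇔ barᵖ p ∈ rules
  open ESystem public

  mkESystem : (ps : List Production) → (∀ p → p ∈ ps → barᵖ p ∈ ps) → ESystem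
  mkESystem ps cl = record
    { rules  = ps
    ; closed = λ p → mk⇔ (cl p) (λ q → subst (_∈ ps) (barᵖ-involutive p) (cl (barᵖ p) q)) }

  open DecMembership _≟P_ using () renaming (_∈?_ to _∈P?_)

  ∅ᴳ : ESystem
  ∅ᴳ = mkESystem [] (λ _ ())

  infixl 6 _∪ᴳ_ _∖ᴳ_
  _∪ᴳ_ : ESystem → ESystem → ESystem
  G ∪ᴳ G′ = mkESystem (rules G ++ rules G′) cl
    where
    open Equivalence
    cl : ∀ p → p ∈ rules G ++ rules G′ → barᵖ p ∈ rules G ++ rules G′
    cl p q with ∈-++⁻ (rules G) q
    ... | inj₁ r = ∈-++⁺ˡ (to (closed G p) r)
    ... | inj₂ r = ∈-++⁺ʳ (rules G) (to (closed G′ p) r)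

  _∖ᴳ_ : ESystem → ESystem → ESystem
  G ∖ᴳ G′ = mkESystem (filter (λ p → ¬? (p ∈P? rules G′)) (rules G)) cl
    where
    open Equivalence
    Q? = λ p → ¬? (p ∈P? rules G′)
    cl : ∀ p → p ∈ filter Q? (rules G) → barᵖ p ∈ filter Q? (rules G)
    cl p q with ∈-filter⁻ Q? {xs = rules G} q
    ... | r , ∉G′ = ∈-filter⁺ Q? (to (closed G p) r) (λ m → ∉G′ (from (closed G′ p) m))

  data _⊢_⇒_ (G : ESystem) : String → String → Set where
    rewriteAt : ∀ u v {x t} → (x ⟶ t) ∈ rules G → G ⊢ u ++ x ∷ v ⇒ (u ++ t ++ v)

  -- The language G(a).
  Lang : ESystem → E → String → Set
  Lang G a t = Star (G ⊢_⇒_) [ fwd a ] t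

  ----------------------------------------------------------------------
  -- Production pairs.  A production p stands for the unordered pair
  -- (p , p̄), so pairs are compared with _≈ₚ_ and not with _≡_.

  Pair : Set
  Pair = Production

  _≈ₚ_ : Pair → Pair → Set
  p ≈ₚ q = p ≡ q ⊎ p ≡ barᵖ q

  _∈ₚ_ : Pair → List Pair → Set
  p ∈ₚ P = Any (p ≈ₚ_) P

  P⟨_⟩ : ESystem → List Pair
  P⟨ G ⟩ = rules G

  G⟨_⟩ : List Pair → ESystem
  G⟨ P ⟩ = mkESystem (P ++ map barᵖ P) cl
    where
    cl : ∀ p → p ∈ P ++ map barᵖ P → barᵖ p ∈ P ++ map barᵖ P
    cl p q with ∈-++⁻ P q
    ... | inj₁ r = ∈-++⁺ʳ P (∈-map⁺ barᵖ r)
    ... | inj₂ r with ∈-map⁻ barᵖ r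
    ...   | q′ , q′∈P , refl = ∈-++⁺ˡ (subst (_∈ P) (sym (barᵖ-involutive q′)) q′∈P)

  -- The dependency graph DG(G): the choice of representatives p, p′ is
  -- immaterial, since s contains y iff s̄ contains ȳ.
  DG_⊢_⊏_ : ESystem → Pair → Pair → Set
  DG G ⊢ p ⊏ p′ =
    p ∈ₚ P⟨ G ⟩ × p′ ∈ₚ P⟨ G ⟩ × ¬ (p ≈ₚ p′) × (lhs p′ ∈ rhs p ⊎ lhs p′ ∈ barˢ (rhs p))

  DG_⊢_⊑_ : ESystem → Pair → Pair → Set
  DG G ⊢ p ⊑ p′ = Star (DG G ⊢_⊏_) p p′

  Fracturable : ESystem → List Pair → Set
  Fracturable G V′ =
    ¬ (∃[ v ] ∃[ v′ ] v ∈ₚ P⟨ G ⟩ × v′ ∈ₚ P⟨ G ⟩ × v ∈ₚ V′ × ¬ (v′ ∈ₚ V′) × DG G ⊢ v ⊑ v′)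

  ----------------------------------------------------------------------
  -- Generalised sequents

  Vertex : Set
  Vertex = ℕ

  -- (w , a , u) is the edge atom w 𝓔ₐ u.
  Edge : Set
  Edge = Vertex × E × Vertex

  Prefixed : Set
  Prefixed = Vertex × S

  -- A finite graph Γ ⊢ Δ.  The two sets are duplicate-free lists, and the
  -- vertices are those labelled by Δ, each exactly once.  The order of the
  -- lists carries no meaning: g-sequents are compared with _≈_ below.
  record GSequent : Set where
    field
      Γ : List Edge
      Δ : List Prefixed
    V : List Vertex
    V = map proj₁ Δ
    field
      Γ-unique : Unique Γ
      Δ-unique : Unique V
      Γ-on-V   : All (λ (w , _ , u) → w ∈ V × u ∈ V) Γ
  open GSequent public

  ∥_∥ : GSequent → ℕ
  ∥ G ∥ = length (Γ G) + length (Δ G)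

  infix 4 _≋_ _≐_⊢_ _≈_
  _≋_ : {A : Set} → List A → List A → Set
  xs ≋ ys = xs ⊆ ys × ys ⊆ xs

  -- G is the g-sequent Γ ⊢ Δ, with Γ and Δ read as sets.
  _≐_⊢_ : GSequent → List Edge → List Prefixed → Set
  G ≐ Γ′ ⊢ Δ′ = Γ G ≋ Γ′ × Δ G ≋ Δ′

  _≈_ : GSequent → GSequent → Set
  G ≈ H = G ≐ Γ H ⊢ Δ H

  open DecSubset (×-≡-dec ℕ._≟_ (×-≡-dec _≟E_ ℕ._≟_)) using () renaming (_⊆?_ to _⊆Γ?_)
  open DecSubset (×-≡-dec ℕ._≟_ _≟S_) using () renaming (_⊆?_ to _⊆Δ?_)

  _≈?_ : Decidable _≈_
  G ≈? H = (Γ G ⊆Γ? Γ H ×-dec Γ H ⊆Γ? Γ G) ×-dec (Δ G ⊆Δ? Δ H ×-dec Δ H ⊆Δ? Δ G)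

  -- The atom w 𝓔ₓ u, where w 𝓔_ā u means u 𝓔ₐ w.
  atom : Vertex → Letter → Vertex → Edge
  atom w (fwd a) u = w , a , u
  atom w (bwd a) u = u , a , w

  -- Γ contains a chain w 𝓔ₛ u.
  data Path (Γ : List Edge) : Vertex → String → Vertex → Set where
    []  : ∀ {w} → Path Γ w [] w
    _∷_ : ∀ {w v u x s} → atom w x v ∈ Γ → Path Γ v s u → Path Γ w (x ∷ s) u

  ----------------------------------------------------------------------
  -- Constraints

  -- (G′ , a) is the label G′(a).
  Label : Set
  Label = ESystem × E

  -- Finite rooted trees with n vertices and labelled edges; in graft C i L,
  -- the new vertex zero is joined to its parent, vertex i of C, by the edge
  -- (i , zero) with label L.
  data Constraint : ℕ → Set where
    root  : Constraint 1
    graft : ∀ {n} → Constraint n → Fin n → Label → Constraint (suc n)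

  Satisfies : ∀ {n} → List Edge → Vec Vertex n → Constraint n → Set
  Satisfies Γ ws       root                = ⊤
  Satisfies Γ (u ∷ ws) (graft C i (G , a)) =
    (∃[ t ] Lang G a t × Path Γ (lookup ws i) t u) × Satisfies Γ ws C

  mapᶜ : (ESystem → ESystem) → ∀ {n} → Constraint n → Constraint n
  mapᶜ f root                = root
  mapᶜ f (graft C i (G , a)) = graft (mapᶜ f C) i (f G , a)

  participating : ∀ {n} → Constraint n → ESystem
  participating root                = ∅ᴳ
  participating (graft C i (G , a)) = participating C ∪ᴳ G

  -- Equality of constraints; labels are compared as languages.
  data _≈ᶜ_ : ∀ {n} → Constraint n → Constraint n → Set where
    root  : root ≈ᶜ root
    graft : ∀ {n} {C D : Constraint n} {i G a H b} → C ≈ᶜ D →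
            (∀ t → Lang G a t ⇔ Lang H b t) →
            graft C i (G , a) ≈ᶜ graft D i (H , b)

  ----------------------------------------------------------------------
  -- Rules and calculi.  Sequent constraints relate the labels of the
  -- premises (first) to those of the conclusion (last).

  data Rule : Set₁ where
    initial   : ∀ {n} → Constraint n → (R : Vec S n → Set) → Rule
    -- w and u are the vertices of the constraint that are principal.
    reach     : ∀ {n} → Constraint n → (w u : Fin n) →
                ∀ {m} → (R : Vec (S × S) (suc m) → S × S → Set) → Rule
    local     : ∀ {m} → (R : Vec S (suc m) → S → Set) → Rule
    expansion : Letter → (R : S × S → S → Set) → Rule
    hornF     : E → String → Rule
    hornB     : E → String → Rule

  Calculus : Set₁
  Calculus = List Rule

  arity : Rule → ℕ
  arity (initial C R)         = 0
  arity (reach C w u {m} R)   = suc m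
  arity (local {m} R)         = suc m
  arity (expansion x R)       = 1
  arity (hornF a s)           = 1
  arity (hornB a s)           = 1

  -- Instances of a rule, with given premises and conclusion.
  data Application : (ρ : Rule) → Vec GSequent (arity ρ) → GSequent → Set₁ where
    initial : ∀ {n} {C : Constraint n} {R} {G}
              (Δ′ : List Prefixed) (ws : Vec Vertex n) (Ss : Vec S n) →
              G ≐ Γ G ⊢ toList (zip ws Ss) ++ Δ′ →
              Satisfies (Γ G) ws C →
              R Ss →
              Application (initial C R) [] G

    reach : ∀ {n} {C : Constraint n} {i j m R} {Hs G}
            (Δ′ : List Prefixed) (vs : Vec Vertex n) →
            (let w = lookup vs i ; u = lookup vs j) →
            (Ss : Vec (S × S) (suc m)) (T T′ : S) →
            Pointwise (λ H (Sᵢ , Sᵢ′) → H ≐ Γ G ⊢ (w , Sᵢ) ∷ (u , Sᵢ′) ∷ Δ′) Hs Ss →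
            G ≐ Γ G ⊢ (w , T) ∷ (u , T′) ∷ Δ′ →
            All (_∈ V G) (toList vs) →
            Satisfies (Γ G) vs C →
            R Ss (T , T′) →
            Application (reach C i j R) Hs G

    local : ∀ {m R Hs G}
            (Δ′ : List Prefixed) (w : Vertex) (Ss : Vec S (suc m)) (T : S) →
            Pointwise (λ H Sᵢ → H ≐ Γ G ⊢ (w , Sᵢ) ∷ Δ′) Hs Ss →
            G ≐ Γ G ⊢ (w , T) ∷ Δ′ →
            R Ss T →
            Application (local R) Hs G

    expansion : ∀ {x R H G}
                (Δ′ : List Prefixed) (w u : Vertex) (S₁ S₂ T : S) →
                u ∉ V G →
                H ≐ atom w x u ∷ Γ G ⊢ (w , S₁) ∷ (u , S₂) ∷ Δ′ →
                G ≐ Γ G ⊢ (w , T) ∷ Δ′ →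
                R (S₁ , S₂) T →
                Application (expansion x R) (H ∷ []) G

    hornF : ∀ {a s H G} (w u : Vertex) →
            Path (Γ G) w s u →
            H ≐ (w , a , u) ∷ Γ G ⊢ Δ G →
            Application (hornF a s) (H ∷ []) G

    hornB : ∀ {a s H G} (w u : Vertex) →
            Path (Γ G) w s u →
            H ≐ (u , a , w) ∷ Γ G ⊢ Δ G →
            Application (hornB a s) (H ∷ []) G

  ----------------------------------------------------------------------
  -- Grammars, absorption, fracture

  Gᵣ : Rule → ESystem
  Gᵣ (initial C R)   = participating C
  Gᵣ (reach C w u R) = participating C
  Gᵣ (local R)       = ∅ᴳ
  Gᵣ (expansion x R) = ∅ᴳ
  Gᵣ (hornF a s)     = G⟨ [ fwd a ⟶ s ] ⟩
  Gᵣ (hornB a s)     = G⟨ [ bwd a ⟶ s ] ⟩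

  Gᶜ : Calculus → ESystem
  Gᶜ = foldr (λ ρ G → Gᵣ ρ ∪ᴳ G) ∅ᴳ

  onConstraint : (ESystem → ESystem) → Rule → Rule
  onConstraint f (initial C R)   = initial (mapᶜ f C) R
  onConstraint f (reach C w u R) = reach (mapᶜ f C) w u R
  onConstraint f ρ               = ρ

  _⊕_ _⊖_ : Rule → ESystem → Rule
  ρ ⊕ G = onConstraint (_∪ᴳ G) ρ
  ρ ⊖ G = onConstraint (_∖ᴳ G) ρ

  -- Equality of rules, with labels of constraints compared as languages.
  data _≈ᵣ_ : Rule → Rule → Set₁ where
    same    : ∀ {ρ} → ρ ≈ᵣ ρ
    initial : ∀ {n} {C D : Constraint n} {R} → C ≈ᶜ D → initial C R ≈ᵣ initial D R
    reach   : ∀ {n} {C D : Constraint n} {w u m} {R : Vec (S × S) (suc m) → S × S → Set} →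
              C ≈ᶜ D → reach C w u R ≈ᵣ reach D w u R

  data IsHorn : Rule → Set where
    hornF : ∀ {a s} → IsHorn (hornF a s)
    hornB : ∀ {a s} → IsHorn (hornB a s)

  isHorn? : ∀ ρ → Dec (IsHorn ρ)
  isHorn? (initial C R)   = no λ ()
  isHorn? (reach C w u R) = no λ ()
  isHorn? (local R)       = no λ ()
  isHorn? (expansion x R) = no λ ()
  isHorn? (hornF a s)     = yes hornF
  isHorn? (hornB a s)     = yes hornB

  data IsInitialOrReach : Rule → Set₁ where
    initial : ∀ {n} {C : Constraint n} {R} → IsInitialOrReach (initial C R)
    reach   : ∀ {n} {C : Constraint n} {w u m} {R : Vec (S × S) (suc m) → S × S → Set} →
              IsInitialOrReach (reach C w u R)

  Implicit : Calculus → Set₁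
  Implicit 𝔄 =
    (∀ ρ → ρ ∈ 𝔄 → ¬ IsHorn ρ) ×
    (∀ ρ → ρ ∈ 𝔄 → IsInitialOrReach ρ → (ρ ⊕ Gᶜ 𝔄) ≈ᵣ ρ)

  _∖Horn : Calculus → Calculus
  𝔅 ∖Horn = filter (¬? ∘ isHorn?) 𝔅

  -- H(p , p̄) and H(p̄ , p) are the same rule, with w and u interchanged.
  hornRule : Pair → Rule
  hornRule (fwd a ⟶ s) = hornF a s
  hornRule (bwd a ⟶ s) = hornB a s

  fracture : Calculus → List Pair → Calculus
  fracture 𝔅 P′ = map (_⊖ G⟨ P′ ⟩) 𝔅 ++ map hornRule P′

  -- The downward space Down(𝔄) = (𝐒 𝔄 , _⩽_).
  data _⋖_ : Calculus → Calculus → Set₁ where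
    fractures : ∀ {𝔅} P′ →
                (∀ {p} → p ∈ₚ P′ → p ∈ₚ P⟨ Gᶜ (𝔅 ∖Horn) ⟩) →
                Fracturable (Gᶜ (𝔅 ∖Horn)) P′ →
                fracture 𝔅 P′ ⋖ 𝔅

  _⩽_ : Calculus → Calculus → Set₁
  _⩽_ = Star _⋖_

  data 𝐒 (𝔄 : Calculus) : Calculus → Set₁ where
    top  : 𝐒 𝔄 𝔄
    down : ∀ {𝔅 ℭ} → 𝐒 𝔄 𝔅 → ℭ ⋖ 𝔅 → 𝐒 𝔄 ℭ

  ----------------------------------------------------------------------
  -- Proofs

  -- Leaves are conclusions of initial rules, as only these have arity 0.
  data ProofTree (𝔄 : Calculus) : GSequent → Set₁ where
    infer : ∀ {ρ Hs G} → ρ ∈ 𝔄 → Application ρ Hs G →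
            (∀ i → ProofTree 𝔄 (lookup Hs i)) → ProofTree 𝔄 G

  sequents : ∀ {𝔄 G} → ProofTree 𝔄 G → List GSequent
  sequents {G = G} (infer _ _ ps) = G ∷ concat (List.tabulate (λ i → sequents (ps i)))

  verticesOf : ∀ {𝔄 G} → ProofTree 𝔄 G → List Vertex
  verticesOf P = concatMap V (sequents P)

  introduced : ∀ {ρ Hs G} → Application ρ Hs G → List Vertex
  introduced (expansion _ w u _ _ _ _ _ _ _) = [ u ]
  introduced _                               = []

  eigenvertices : ∀ {𝔄 G} → ProofTree 𝔄 G → List Vertex
  eigenvertices (infer _ α ps) = introduced α ++ concat (List.tabulate (λ i → eigenvertices (ps i)))

  -- The vertex introduced by an expansion rule is fresh for the whole proof:
  -- it occurs only in the subproof above that rule.  Since V grows from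
  -- conclusion to premise, the side condition u ∉ V G excludes it from all
  -- g-sequents below, and Fresh excludes it from the other branches.
  Fresh : ∀ {𝔄 G} → ProofTree 𝔄 G → Set
  Fresh (infer _ _ ps) =
    (∀ i → Fresh (ps i)) ×
    (∀ i j → i ≢ j → Disjoint (eigenvertices (ps i)) (verticesOf (ps j)))

  record Proof (𝔄 : Calculus) (G : GSequent) : Set₁ where
    field
      tree  : ProofTree 𝔄 G
      fresh : Fresh tree
  open Proof public

  ‖_‖ : ∀ {𝔄 G} → Proof 𝔄 G → ℕ
  ‖ P ‖ = foldr _⊔_ 0 (map ∥_∥ (sequents (tree P))) * length (deduplicate _≈?_ (sequents (tree P)))

  ----------------------------------------------------------------------
  -- Proofs as inputs and outputs of programs.  A node of a proof is coded
  -- by the position of the rule in the calculus, the kind of the rule with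
  -- its principal vertices and the edge atom it introduces (read upwards),
  -- the conclusion, and the subproofs.  Numbers are written in binary.

  codeE : E → Tree
  codeE a = codeℕ (toℕ (Inverse.to E-finite a))

  codeS : S → Tree
  codeS T = codeℕ (Inverse.to S-countable T)

  codeEdge : Edge → Tree
  codeEdge (w , a , u) = codeList (codeℕ w ∷ codeE a ∷ codeℕ u ∷ [])

  codePrefixed : Prefixed → Tree
  codePrefixed (w , T) = node (codeℕ w) (codeS T)

  codeGSequent : GSequent → Tree
  codeGSequent G = node (codeList (map codeEdge (Γ G))) (codeList (map codePrefixed (Δ G)))

  codeApplication : ∀ {ρ Hs G} → Application ρ Hs G → Tree
  codeApplication (initial _ ws _ _ _ _) =
    codeList (codeℕ 0 ∷ map codeℕ (toList ws))
  codeApplication (reach _ vs _ _ _ _ _ _ _ _) =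
    codeList (codeℕ 1 ∷ map codeℕ (toList vs))
  codeApplication (local _ w _ _ _ _ _) =
    codeList (codeℕ 2 ∷ codeℕ w ∷ [])
  codeApplication (expansion {x = x} _ w u _ _ _ _ _ _ _) =
    codeList (codeℕ 3 ∷ codeℕ w ∷ codeℕ u ∷ codeEdge (atom w x u) ∷ [])
  codeApplication (hornF {a = a} w u _ _) =
    codeList (codeℕ 4 ∷ codeℕ w ∷ codeℕ u ∷ codeEdge (w , a , u) ∷ [])
  codeApplication (hornB {a = a} w u _ _) =
    codeList (codeℕ 5 ∷ codeℕ w ∷ codeℕ u ∷ codeEdge (u , a , w) ∷ [])

  codeTree : ∀ {𝔄 G} → ProofTree 𝔄 G → Tree
  codeTree {G = G} (infer ρ∈𝔄 α ps) =
    codeList ( codeℕ (toℕ (index ρ∈𝔄)) ∷ codeApplication α ∷ codeGSequent G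
             ∷ codeList (List.tabulate (λ i → codeTree (ps i))) ∷ [])

  codeProof : ∀ {𝔄 G} → Proof 𝔄 G → Tree
  codeProof P = codeTree (tree P)

{-# OPTIONS --safe #-}
module Submission where

-- An edge added by a Horn rule w 𝓔ₛ u ⊢ w 𝓔ₐ u is parallel to a path labelled s, and a ⟶ s is a
-- production of the implicit calculus 𝔄.  So whatever reachability the edge provides is available
-- without it to the labels of 𝔄, which absorb G(𝔄): every Horn inference can be deleted, together
-- with its edge in all g-sequents above.  Reading a proof upwards, this keeps exactly the edges of
-- the root and those added by expansions, hence can be done by one traversal that carries the
-- current edge list.  Since eigenvertices are fresh, the edges kept in a g-sequent depend on the
-- g-sequent only, not on its position in the proof, so the number of distinct g-sequents does not
-- grow.  Fracturing keeps the positions of the rules of 𝔄, so rule numbers need no translation.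

open import Defs
open import Data.Bool using (T)
open import Data.Fin using (Fin; zero; suc; toℕ; #_)
import Data.Fin.Properties as Fin
open import Data.List using (List; []; _∷_; [_]; _++_; map; concat; foldr; length; reverse; deduplicate)
import Data.List as List
open import Data.List.Properties using (++-assoc; ++-identityʳ; map-++; reverse-++; unfold-reverse)
open import Data.List.Membership.Propositional using (_∈_; _∉_; lose; find)
open import Data.List.Membership.Propositional.Properties using (∈-++⁺ˡ; ∈-++⁺ʳ; ∈-++⁻; ∈-filter⁻; ∈-lookup; ∈-deduplicate⁻)
open import Data.List.Relation.Binary.Subset.Propositional using (_⊆_)
import Data.List.Relation.Binary.Subset.Propositional.Properties as ⊆
open import Data.List.Relation.Unary.All as All using (All; []; _∷_)
import Data.List.Relation.Unary.All.Properties as All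
open import Data.List.Relation.Unary.AllPairs as AllPairs using (AllPairs; []; _∷_)
import Data.List.Relation.Unary.AllPairs.Properties as AllPairs
open import Data.List.Relation.Unary.Any as Any using (Any; here; there; index)
import Data.List.Relation.Unary.Any.Properties as Any
open import Data.List.Relation.Unary.Unique.Propositional using (Unique)
open import Data.Nat using (ℕ; zero; suc; _≤_; _<_; _+_; _*_; _^_; _⊔_; z≤n; s≤s; _≤ᵇ_)
import Data.Nat.Properties as ℕ
open import Data.Nat.Tactic.RingSolver using (solve-∀)
open import Data.Product using (Σ-syntax; ∃-syntax; _×_; _,_; proj₁; proj₂)
open import Data.Sum using (_⊎_; inj₁; inj₂)
open import Data.Vec using (Vec; []; _∷_; lookup; tabulate)
open import Data.Vec.Properties using (lookup∘tabulate)
open import Data.Vec.Relation.Binary.Pointwise.Extensional using (ext; extensional⇒inductive)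
open import Data.Vec.Relation.Binary.Pointwise.Inductive as Pointwise using (Pointwise)
import Data.Vec.Relation.Unary.All as VecAll
open VecAll using ([]; _∷_)
open import Data.Vec.Relation.Unary.All.Properties using (lookup⁺)
open import Function using (_∘_; id)
open import Function.Bundles using (Equivalence)
open import Function.Construct.Identity using (⇔-id)
open import Relation.Binary.Construct.Closure.ReflexiveTransitive as Star using (Star; ε; _◅_; _◅◅_)
open import Relation.Binary.Definitions using (Decidable)
open import Relation.Binary.PropositionalEquality using (_≡_; _≢_; refl; sym; trans; cong; cong₂; subst; subst₂)
open import Relation.Binary.PropositionalEquality.Properties using (subst-injective)
open import Relation.Nullary using (¬_; contradiction; yes; no)
open import Relation.Nullary.Decidable using (¬?)

-- Lists and vectors

module _ {A B : Set} (_~_ : A → A → Set) (_≈_ : B → B → Set) (_↦_ : A → B → Set)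
         (reflects : ∀ {x x′ y y′} → x ↦ y → x′ ↦ y′ → y ≈ y′ → x ~ x′)
         (≈-equates : ∀ {x y z} → y ≈ x → z ≈ x → y ≈ z) where

  -- Pigeonhole on the positions in `ys` that witness the images: two entries of `xs` sharing a
  -- position have `≈` images, so `reflects` makes them `~`, against distinctness. `↦` is a
  -- relation, as one eliminated g-sequent may have several sources.
  length-≤ : ∀ {xs ys} → AllPairs (λ x x′ → ¬ (x ~ x′)) xs → (∀ {x x′} → x ~ x′ → x′ ~ x) →
             All (λ x → ∃[ y ] x ↦ y × Any (y ≈_) ys) xs → length xs ≤ length ys
  length-≤ {xs} {ys} distinct ~-sym images = Fin.injective⇒≤ {f = position} λ {i} {j} → injective i j
    where
    image : ∀ i → ∃[ y ] List.lookup xs i ↦ y × Any (y ≈_) ys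
    image i = All.lookup images (∈-lookup i)

    position : Fin (length xs) → Fin (length ys)
    position i = index (proj₂ (proj₂ (image i)))

    coincide : ∀ i j → position i ≡ position j → List.lookup xs i ~ List.lookup xs j
    coincide i j eq with image i | image j
    ... | y , x↦y , y∈ | y′ , x′↦y′ , y′∈ =
      reflects x↦y x′↦y′
        (≈-equates (Any.lookup-index y∈) (subst (λ k → y′ ≈ List.lookup ys k) (sym eq) (Any.lookup-index y′∈)))

    apart : ∀ {zs} → AllPairs (λ x x′ → ¬ (x ~ x′)) zs →
            ∀ i j → List.lookup zs i ~ List.lookup zs j → i ≡ j
    apart (_ ∷ _)  zero    zero    _ = refl
    apart (ap ∷ _) zero    (suc j) r = contradiction r (All.lookup ap (∈-lookup j))
    apart (ap ∷ _) (suc i) zero    r = contradiction (~-sym r) (All.lookup ap (∈-lookup i))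
    apart (_ ∷ d)  (suc i) (suc j) r = cong suc (apart d i j r)

    injective : ∀ i j → position i ≡ position j → i ≡ j
    injective i j eq = apart distinct i j (coincide i j eq)

unique-⊆⇒length-≤ : ∀ {A : Set} {xs ys : List A} → Unique xs → xs ⊆ ys → length xs ≤ length ys
unique-⊆⇒length-≤ uniq xs⊆ys =
  length-≤ _≡_ _≡_ _≡_ (λ { refl refl → id }) (λ { refl refl → refl }) uniq sym
    (All.tabulate λ x∈ → _ , refl , xs⊆ys x∈)

foldr-⊔-≤ : ∀ {A : Set} (f : A → ℕ) xs {b} → (∀ {x} → x ∈ xs → f x ≤ b) → foldr _⊔_ 0 (map f xs) ≤ b
foldr-⊔-≤ f []       h = z≤n
foldr-⊔-≤ f (x ∷ xs) h = ℕ.⊔-lub (h (here refl)) (foldr-⊔-≤ f xs (h ∘ there))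

≤-foldr-⊔ : ∀ {A : Set} (f : A → ℕ) {x xs} → x ∈ xs → f x ≤ foldr _⊔_ 0 (map f xs)
≤-foldr-⊔ f (here refl) = ℕ.m≤m⊔n _ _
≤-foldr-⊔ f (there x∈)  = ℕ.≤-trans (≤-foldr-⊔ f x∈) (ℕ.m≤n⊔m _ _)

∈-concat-tabulate⁺ : ∀ {A : Set} {n} (f : Fin n → List A) i {x} → x ∈ f i → x ∈ concat (List.tabulate f)
∈-concat-tabulate⁺ f i x∈ = Any.concat⁺ (Any.tabulate⁺ i x∈)

∈-concat-tabulate⁻ : ∀ {A : Set} {n} (f : Fin n → List A) {x} →
                     x ∈ concat (List.tabulate f) → ∃[ i ] x ∈ f i
∈-concat-tabulate⁻ f x∈ = Any.tabulate⁻ (Any.concat⁻ (List.tabulate f) x∈)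

deduplicate-distinct : ∀ {A : Set} {_~_ : A → A → Set} (_~?_ : Decidable _~_) xs →
                       AllPairs (λ x y → ¬ (x ~ y)) (deduplicate _~?_ xs)
deduplicate-distinct _~?_ []       = []
deduplicate-distinct _~?_ (x ∷ xs) =
  All.all-filter (¬? ∘ (x ~?_)) (deduplicate _~?_ xs) ∷ AllPairs.filter⁺ _ (deduplicate-distinct _~?_ xs)

-- The program and its running time

pattern Main     = zero
pattern Convert  = suc zero
pattern Converts = suc (suc zero)
pattern Kind     = suc (suc (suc zero))

-- The results of Kind; on all other kinds it returns leaf.
hornTag expandingTag : Tree
hornTag      = node leaf leaf
expandingTag = node leaf (node leaf leaf)

-- Elimination preserves the conclusion, so `Convert` starts with the edges and labels coded at the
-- root.
mainBody : Exp 4 1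
mainBody =
  match (var (# 0)) leaf
  (match (var (# 1)) leaf
  (match (var (# 1)) leaf
  (call Convert (node (var (# 0)) (var (# 6))))))

-- Applied to node (node γ δ) x, where x codes a proof and γ and δ code the edges and
-- labels that its conclusion is to have.
convertBody : Exp 4 1
convertBody =
  match (var (# 0)) leaf
  (match (var (# 1)) leaf
  (match (var (# 1)) leaf
  (match (var (# 1)) leaf
  (match (var (# 1)) leaf
  (match (var (# 4)) leaf
  -- In scope: 0 is the kind, 1 the rest of the application code, 2 the subproofs, 6 the application
  -- code, 8 the rule number and 10 the pair of `γ` and `δ`.
  (match (call Kind (var (# 0)))
    (match (var (# 10)) leaf
      (node (var (# 10)) (node (var (# 8)) (node (var (# 12))
        (node (call Converts (node (var (# 0)) (var (# 4)))) leaf)))))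
    (match (var (# 1))
      -- Horn rule: the result is that of its only subproof, with the same edges and labels.
      (match (var (# 4)) leaf
        (call Convert (node (var (# 14)) (var (# 0)))))
      -- Expansion: its edge atom, fourth in the application code, is prepended to the edges passed
      -- on.
      (match (var (# 14)) leaf
      (match (var (# 7)) leaf
      (match (var (# 1)) leaf
      (match (var (# 1)) leaf
        (node (var (# 20)) (node (var (# 18)) (node (var (# 22))
          (node (call Converts (node (node (var (# 0)) (var (# 6))) (var (# 14)))) leaf)))))))))))))))

-- Applied to node γ xs, where xs codes a list of proofs and γ the edges that their
-- conclusions are to have.
convertsBody : Exp 4 1
convertsBody =
  match (var (# 0)) leaf
  (match (var (# 1)) leaf
  (match (var (# 0)) leaf
  (match (var (# 1)) leaf
  (match (var (# 1)) leaf
  (match (var (# 0)) leaf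
    -- The labels come from the subproof's own conclusion, since elimination affects edges only.
    (node (call Convert (node (node (var (# 10)) (var (# 1))) (var (# 8))))
          (call Converts (node (var (# 10)) (var (# 9))))))))))

-- Distinguishes the binary codes of the numbers 0 to 5.
kindBody : Exp 4 1
kindBody =
  match (var (# 0)) leaf
  (match (var (# 1)) leaf
  -- Only two-digit codes remain: a leaf as low digit means 4, else a leaf as high digit means 5,
  -- else the number is 3.
  (match (var (# 2)) (node leaf leaf)
  (match (var (# 2)) (node leaf leaf)
    (node leaf (node leaf leaf)))))

eliminator : Program
eliminator = record { extra = 3 ; bodies = mainBody ∷ convertBody ∷ convertsBody ∷ kindBody ∷ [] }

bodies : Vec (Exp 4 1) 4
bodies = Program.bodies eliminator

size-positive : ∀ x → 1 ≤ size x
size-positive leaf       = ℕ.≤-refl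
size-positive (node x y) = s≤s z≤n

size-left : ∀ x y → size x ≤ size (node x y)
size-left x y = ℕ.m≤n⇒m≤1+n (ℕ.m≤m+n (size x) (size y))

size-right : ∀ x y → size y ≤ size (node x y)
size-right x y = ℕ.m≤n⇒m≤1+n (ℕ.m≤n+m (size y) (size x))

size-third : ∀ x y z r → size z ≤ size (node x (node y (node z r)))
size-third x y z r =
  ℕ.≤-trans (size-left z r) (ℕ.≤-trans (size-right y (node z r)) (size-right x (node y (node z r))))

-- Costs are measured in multiples of U, which exceeds the sizes of the values read.
module Cost (U : ℕ) (1≤U : 1 ≤ U) where

  Fits : Tree → Set
  Fits v = size v < U

  -- Evaluation within k U + m steps, where m accounts for the recursive calls.
  record Runs {n} (Γ : Vec Tree n) (e : Exp 4 n) (v : Tree) (k m : ℕ) : Set where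
    constructor runs
    field
      evaluate : VecAll.All Fits Γ → ∃[ t ] Γ ⊢[ bodies ] e ⇓ v ⟨ t ⟩ × t ≤ k * U + m
  open Runs

  -- The bound has no `U` part: it enters the `m` of the caller, which is estimated by induction on
  -- the proof.
  record Returns (g : Fin 4) (u v : Tree) (m : ℕ) : Set where
    constructor returns
    field
      evaluation : ∃[ t ] (u ∷ []) ⊢[ bodies ] lookup bodies g ⇓ v ⟨ t ⟩ × t ≤ m
  open Returns public

  -- The evaluation step itself is charged a full `U`, so that coefficients of `U` merely count
  -- constructs.
  add-cost : ∀ {s t} k l m n → s ≤ k * U + m → t ≤ l * U + n → suc (s + t) ≤ suc (k + l) * U + (m + n)
  add-cost {s} {t} k l m n p q = begin
    1 + (s + t)                             ≤⟨ ℕ.+-mono-≤ 1≤U (ℕ.+-mono-≤ p q) ⟩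
    U + ((k * U + m) + (l * U + n))         ≡⟨ regroup k l m n U ⟩
    suc (k + l) * U + (m + n)               ∎
    where
    open ℕ.≤-Reasoning
    regroup : ∀ k l m n u → u + ((k * u + m) + (l * u + n)) ≡ suc (k + l) * u + (m + n)
    regroup = solve-∀

  unit : ∀ {t} → t ≤ U → t ≤ 1 * U + 0
  unit t≤U = subst (_ ≤_) (sym (trans (ℕ.+-identityʳ (1 * U)) (ℕ.*-identityˡ U))) t≤U

  module _ {n} {Γ : Vec Tree n} where

    run-var : ∀ i → Runs Γ (var i) (lookup Γ i) 1 0
    run-var i = runs λ fits → _ , var i , unit (lookup⁺ fits i)

    run-leaf : Runs Γ leaf leaf 1 0
    run-leaf = runs λ _ → _ , leaf , unit 1≤U

    run-node : ∀ {d e u v k l m n} → Runs Γ d u k m → Runs Γ e v l n →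
               Runs Γ (node d e) (node u v) (suc (k + l)) (m + n)
    run-node {k = k} {l} {m} {n} r r′ = runs λ fits →
      let _ , d , p = evaluate r fits ; _ , e , q = evaluate r′ fits in _ , node d e , add-cost k l m n p q

    run-match₀ : ∀ {d e f v k l m n} → Runs Γ d leaf k m → Runs Γ e v l n →
                 Runs Γ (match d e f) v (suc (k + l)) (m + n)
    run-match₀ {k = k} {l} {m} {n} r r′ = runs λ fits →
      let _ , d , p = evaluate r fits ; _ , e , q = evaluate r′ fits in _ , match₀ d e , add-cost k l m n p q

    run-match₁ : ∀ {d e f x y v k l m n} → Fits (node x y) → Runs Γ d (node x y) k m → Runs (x ∷ y ∷ Γ) f v l n →
                 Runs Γ (match d e f) v (suc (k + l)) (m + n)
    run-match₁ {x = x} {y} {k = k} {l} {m} {n} small r r′ = runs λ fits →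
      let _ , d , p = evaluate r fits
          _ , e , q = evaluate r′ (ℕ.≤-<-trans (size-left x y) small ∷ ℕ.≤-<-trans (size-right x y) small ∷ fits)
      in _ , match₁ d e , add-cost k l m n p q

    match-leaf : ∀ i {e f v l n} → lookup Γ i ≡ leaf → Runs Γ e v l n →
                 Runs Γ (match (var i) e f) v (2 + l) n
    match-leaf i eq r = run-match₀ (subst (λ u → Runs Γ (var i) u 1 0) eq (run-var i)) r

    match-node : ∀ i {e f x y v l n} → lookup Γ i ≡ node x y → Runs (x ∷ y ∷ Γ) f v l n →
                 Runs Γ (match (var i) e f) v (2 + l) n
    match-node i eq r = runs λ fits →
      evaluate (run-match₁ (subst Fits eq (lookup⁺ fits i)) (subst (λ u → Runs Γ (var i) u 1 0) eq (run-var i)) r) fits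

    run-call : ∀ {g e u v k m n} → Runs Γ e u k m → Returns g u v n → Runs Γ (call g e) v (suc k) (m + n)
    run-call {k = k} {m} {n} r (returns (t , d , q)) = runs λ fits →
      let s , e , p = evaluate r fits
      in _ , call e d ,
         subst (λ j → suc (s + t) ≤ suc j * U + (m + n)) (ℕ.+-identityʳ k) (add-cost k 0 m n p q)

  body : ∀ {g u v k m} → Fits u → Runs (u ∷ []) (lookup bodies g) v k m → Returns g u v (k * U + m)
  body small r = returns (evaluate r (small ∷ []))

  -- For callees without recursive calls, such as `Kind`: their cost merges into the coefficient of
  -- `U`.
  run-call-var : ∀ {n} {Γ : Vec Tree n} i {g v k} → Runs (lookup Γ i ∷ []) (lookup bodies g) v k 0 →
                 Runs Γ (call g (var i)) v (2 + k) 0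
  run-call-var {Γ = Γ} i {v = v} {k} r = runs λ fits →
    let t , d , p = evaluate (run-call (run-var i) (body (lookup⁺ fits i) r)) fits
    in t , d , subst (t ≤_) (regroup k U) p
    where
    regroup : ∀ k u → 2 * u + (0 + (k * u + 0)) ≡ (2 + k) * u + 0
    regroup = solve-∀

  -- Once `k` is known, `T (k ≤ᵇ l)` computes to the unit type and is filled in silently; this
  -- allows the generous round bounds 20 and 100.
  weaken : ∀ {n} {Γ : Vec Tree n} {e v k m n} l → m ≤ n → Runs Γ e v k m → {k≤l : T (k ≤ᵇ l)} → Runs Γ e v l n
  weaken {k = k} l m≤n r {k≤l} = runs λ fits →
    let t , d , p = evaluate r fits
    in t , d , ℕ.≤-trans p (ℕ.+-mono-≤ (ℕ.*-monoˡ-≤ U (ℕ.≤ᵇ⇒≤ k l k≤l)) m≤n)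

  plain-kind : ∀ k → Runs (codeℕ (toℕ {3} k) ∷ []) kindBody leaf 20 0
  plain-kind zero             = weaken 20 z≤n (match-leaf (# 0) refl run-leaf)
  plain-kind (suc zero)       = weaken 20 z≤n (match-node (# 0) refl (match-leaf (# 1) refl run-leaf))
  plain-kind (suc (suc zero)) = weaken 20 z≤n (match-node (# 0) refl (match-leaf (# 1) refl run-leaf))

  forward-kind : Runs (codeℕ 4 ∷ []) kindBody hornTag 20 0
  forward-kind = weaken 20 z≤n
    (match-node (# 0) refl (match-node (# 1) refl (match-leaf (# 2) refl (run-node run-leaf run-leaf))))

  backward-kind : Runs (codeℕ 5 ∷ []) kindBody hornTag 20 0
  backward-kind = weaken 20 z≤n
    (match-node (# 0) refl (match-node (# 1) refl (match-node (# 2) refl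
    (match-leaf (# 2) refl (run-node run-leaf run-leaf)))))

  expanding-kind : Runs (codeℕ 3 ∷ []) kindBody expandingTag 20 0
  expanding-kind = weaken 20 z≤n
    (match-node (# 0) refl (match-node (# 1) refl (match-node (# 2) refl
    (match-node (# 2) refl (run-node run-leaf (run-node run-leaf run-leaf))))))

  module _ {γ δ idx kind gs : Tree} where

    private
      q = node γ δ
      input output : Tree → Tree → Tree
      input rest subs  = node q (node idx (node (node kind rest) (node gs (node subs leaf))))
      output rest subs = node idx (node (node kind rest) (node q (node subs leaf)))

    convert-plain : ∀ {rest subs subs′ m} → Fits (input rest subs) → Runs (kind ∷ []) kindBody leaf 20 0 →
                    Returns Converts (node γ subs) subs′ m →
                    Returns Convert (input rest subs) (output rest subs′) (100 * U + m)
    convert-plain {m = m} small k r = body small (weaken 100 (ℕ.≤-reflexive (ℕ.+-identityʳ m)) (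
      match-node (# 0) refl (match-node (# 1) refl (match-node (# 1) refl (match-node (# 1) refl
      (match-node (# 1) refl (match-node (# 4) refl
      (run-match₀ (run-call-var (# 0) k)
      (match-node (# 10) refl
        (run-node (run-var (# 10)) (run-node (run-var (# 8)) (run-node (run-var (# 12))
          (run-node (run-call (run-node (run-var (# 0)) (run-var (# 4))) r) run-leaf)))))))))))))

    convert-expanding : 6 ≤ U → ∀ {w u e nil subs subs′ m} (let rest = node w (node u (node e nil))) →
                        Fits (input rest subs) → Runs (kind ∷ []) kindBody expandingTag 20 0 →
                        Returns Converts (node (node e γ) subs) subs′ m →
                        Returns Convert (input rest subs) (output rest subs′) (100 * U + m)
    convert-expanding 6≤U {m = m} small k r = body small (weaken 100 (ℕ.≤-reflexive (ℕ.+-identityʳ m)) (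
      match-node (# 0) refl (match-node (# 1) refl (match-node (# 1) refl (match-node (# 1) refl
      (match-node (# 1) refl (match-node (# 4) refl
      -- The matched value comes from a call and not from the environment; it is `expandingTag`, of
      -- size 5, and so fits below `U`.
      (run-match₁ 6≤U (run-call-var (# 0) k)
      (match-node (# 1) refl
      (match-node (# 14) refl
      (match-node (# 7) refl
      (match-node (# 1) refl
      (match-node (# 1) refl
        (run-node (run-var (# 20)) (run-node (run-var (# 18)) (run-node (run-var (# 22))
          (run-node (run-call (run-node (run-node (run-var (# 0)) (run-var (# 6))) (run-var (# 14))) r)
                    run-leaf)))))))))))))))))

    convert-horn : 6 ≤ U → ∀ {rest p y m} → Fits (input rest (node p leaf)) → Runs (kind ∷ []) kindBody hornTag 20 0 →
                   Returns Convert (node q p) y m →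
                   Returns Convert (input rest (node p leaf)) y (100 * U + m)
    convert-horn 6≤U small k r = body small (weaken 100 ℕ.≤-refl (
      match-node (# 0) refl (match-node (# 1) refl (match-node (# 1) refl (match-node (# 1) refl
      (match-node (# 1) refl (match-node (# 4) refl
      (run-match₁ (ℕ.≤-trans (ℕ.≤ᵇ⇒≤ 4 6 _) 6≤U) (run-call-var (# 0) k)
      (match-leaf (# 1) refl
      (match-node (# 4) refl
      (run-call (run-node (run-var (# 14)) (run-var (# 0))) r)))))))))))

  converts-[] : ∀ {γ} → Fits (node γ leaf) → Returns Converts (node γ leaf) leaf (100 * U + 0)
  converts-[] small = body small (weaken 100 z≤n (match-node (# 0) refl (match-leaf (# 1) refl run-leaf)))

  -- A proof whose conclusion has labels coded by δ.
  data Labelled : Tree → Tree → Set where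
    labelled : ∀ {idx app γ δ r} → Labelled (node idx (node app (node (node γ δ) r))) δ

  converts-∷ : ∀ {γ δ p ps y ys m n} → Labelled p δ → Fits (node γ (node p ps)) →
               Returns Convert (node (node γ δ) p) y m → Returns Converts (node γ ps) ys n →
               Returns Converts (node γ (node p ps)) (node y ys) (100 * U + (m + n))
  converts-∷ labelled small r s = body small (weaken 100 ℕ.≤-refl (
    match-node (# 0) refl (match-node (# 1) refl (match-node (# 0) refl
    (match-node (# 1) refl (match-node (# 1) refl (match-node (# 0) refl
      (run-node (run-call (run-node (run-node (run-var (# 10)) (run-var (# 1))) (run-var (# 8))) r)
                (run-call (run-node (run-var (# 10)) (run-var (# 9))) s)))))))))

  return-main : ∀ {idx app gs r y m} (let x = node idx (node app (node gs r))) → Fits x →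
                Returns Convert (node gs x) y m → Returns Main x y (100 * U + m)
  return-main small r = body small (weaken 100 ℕ.≤-refl (
    match-node (# 0) refl (match-node (# 1) refl (match-node (# 1) refl
    (run-call (run-node (run-var (# 0)) (run-var (# 6))) r)))))

  weaken-returns : ∀ {g u v m n} → m ≤ n → Returns g u v m → Returns g u v n
  weaken-returns m≤n (returns (t , d , p)) = returns (t , d , ℕ.≤-trans p m≤n)

  labelled-size : ∀ {p δ} → Labelled p δ → size δ ≤ size p
  labelled-size (labelled {idx} {app} {γ} {δ} {r}) =
    ℕ.≤-trans (size-right γ δ) (size-third idx app (node γ δ) r)

  -- Each cell of the list and its final leaf add one to the size of the code, which pays for one
  -- run of the body of `Converts`; the sizes of the entries pay for `Convert`.
  convert-all : ∀ {n γ} (p δ y : Fin n → Tree) → (∀ i → Labelled (p i) (δ i)) →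
                Fits (node γ (codeList (List.tabulate p))) →
                (∀ i → Returns Convert (node (node γ (δ i)) (p i)) (y i) (size (p i) * (100 * U))) →
                Returns Converts (node γ (codeList (List.tabulate p))) (codeList (List.tabulate y))
                        (size (codeList (List.tabulate p)) * (100 * U))
  convert-all {zero} p δ y l small r = converts-[] small
  convert-all {suc n} {γ} p δ y l small r =
    weaken-returns (ℕ.≤-reflexive (cong (100 * U +_) (sym (ℕ.*-distribʳ-+ (100 * U) (size (p zero)) (size ps)))))
      (converts-∷ (l zero) small (r zero)
        (convert-all (p ∘ suc) (δ ∘ suc) (y ∘ suc) (l ∘ suc)
          (ℕ.≤-<-trans (s≤s (ℕ.+-monoʳ-≤ (size γ) (size-right (p zero) ps))) small) (r ∘ suc)))
    where ps = codeList (List.tabulate (p ∘ suc))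

codeList-size : ∀ {n} (f : Fin n → Tree) i → size (f i) ≤ size (codeList (List.tabulate f))
codeList-size f zero    = size-left (f zero) _
codeList-size f (suc i) = ℕ.≤-trans (codeList-size (f ∘ suc) i) (size-right (f zero) _)

-- Subproofs are indexed by the arities of two rules that are only propositionally equal; their
-- codes must still agree.
tabulate-subst : ∀ {A : Set} {m n} (eq : m ≡ n) (f : Fin n → A) →
                 List.tabulate (f ∘ subst Fin eq) ≡ List.tabulate f
tabulate-subst refl f = refl

module HornElimination (Sig : Signature) where
  open Signature Sig
  open Calculi Sig
  open Equivalence

  -- Derivations

  _⊢_⇒*_ : ESystem → String → String → Set
  G ⊢ s ⇒* t = Star (G ⊢_⇒_) s t

  ⇒-mono : ∀ {G G′} → rules G ⊆ rules G′ → ∀ {s t} → G ⊢ s ⇒ t → G′ ⊢ s ⇒ t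
  ⇒-mono sub (rewriteAt u v p∈) = rewriteAt u v (sub p∈)

  ⇒*-mono : ∀ {G G′} → rules G ⊆ rules G′ → ∀ {s t} → G ⊢ s ⇒* t → G′ ⊢ s ⇒* t
  ⇒*-mono {G} {G′} sub = Star.map (⇒-mono {G} {G′} sub)

  module _ {G : ESystem} where

    production : ∀ {x s} → (x ⟶ s) ∈ rules G → G ⊢ [ x ] ⇒* s
    production {x} {s} p∈ = subst (G ⊢ [ x ] ⇒_) (++-identityʳ s) (rewriteAt [] [] p∈) ◅ ε

    ⇒-++ˡ : ∀ r {s t} → G ⊢ s ⇒ t → G ⊢ r ++ s ⇒ (r ++ t)
    ⇒-++ˡ r (rewriteAt u v {x} {t} p∈) =
      subst₂ (G ⊢_⇒_) (++-assoc r u (x ∷ v)) (++-assoc r u (t ++ v)) (rewriteAt (r ++ u) v p∈)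

    ⇒-++ʳ : ∀ r {s t} → G ⊢ s ⇒ t → G ⊢ s ++ r ⇒ (t ++ r)
    ⇒-++ʳ r (rewriteAt u v {x} {t} p∈) =
      subst₂ (G ⊢_⇒_) (sym (++-assoc u (x ∷ v) r))
        (trans (cong (u ++_) (sym (++-assoc t v r))) (sym (++-assoc u (t ++ v) r)))
        (rewriteAt u (v ++ r) p∈)

    ⇒*-++ : ∀ {s s′ t t′} → G ⊢ s ⇒* s′ → G ⊢ t ⇒* t′ → G ⊢ s ++ t ⇒* (s′ ++ t′)
    ⇒*-++ {s′ = s′} {t = t} ds dt = Star.gmap (_++ t) (⇒-++ʳ t) ds ◅◅ Star.gmap (s′ ++_) (⇒-++ˡ s′) dt

    barˢ-++ : ∀ s t → barˢ (s ++ t) ≡ barˢ t ++ barˢ s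
    barˢ-++ s t = trans (cong reverse (map-++ bar s t)) (reverse-++ (map bar s) (map bar t))

    barˢ-infix : ∀ u s v → barˢ (u ++ s ++ v) ≡ barˢ v ++ barˢ s ++ barˢ u
    barˢ-infix u s v =
      trans (barˢ-++ u (s ++ v)) (trans (cong (_++ barˢ u) (barˢ-++ s v)) (++-assoc (barˢ v) (barˢ s) (barˢ u)))

    -- The barred production is available by `closed`; since barring reverses strings, the contexts
    -- `u` and `v` change places.
    ⇒-bar : ∀ {s t} → G ⊢ s ⇒ t → G ⊢ barˢ s ⇒ barˢ t
    ⇒-bar (rewriteAt u v {x} {t} p∈) =
      subst₂ (G ⊢_⇒_) (sym (barˢ-infix u [ x ] v)) (sym (barˢ-infix u t v))
        (rewriteAt (barˢ v) (barˢ u) (to (closed G _) p∈))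

  -- Paths

  atom-bar : ∀ w x u → atom u (bar x) w ≡ atom w x u
  atom-bar w (fwd a) u = refl
  atom-bar w (bwd a) u = refl

  path-mono : ∀ {Γ Γ′} → Γ ⊆ Γ′ → ∀ {w s u} → Path Γ w s u → Path Γ′ w s u
  path-mono sub []       = []
  path-mono sub (e ∷ es) = sub e ∷ path-mono sub es

  _++ᵖ_ : ∀ {Γ w s v t u} → Path Γ w s v → Path Γ v t u → Path Γ w (s ++ t) u
  []       ++ᵖ q = q
  (e ∷ es) ++ᵖ q = e ∷ (es ++ᵖ q)

  path-bar : ∀ {Γ w s u} → Path Γ w s u → Path Γ u (barˢ s) w
  path-bar []                              = []
  path-bar {Γ} {w} (_∷_ {v = v} {u} {x} {s} e es) =
    subst (λ t → Path Γ u t w) (sym (unfold-reverse (bar x) (map bar s)))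
      (path-bar es ++ᵖ (subst (_∈ Γ) (sym (atom-bar w x v)) e ∷ []))

  -- Every step in Γ is simulated by a path in Γ′, up to rewriting with G.
  Covers : ESystem → List Edge → List Edge → Set
  Covers G Γ Γ′ = ∀ {w x u} → atom w x u ∈ Γ → ∃[ t ] G ⊢ [ x ] ⇒* t × Path Γ′ w t u

  module _ {G : ESystem} where

    ⊆⇒covers : ∀ {Γ Γ′} → Γ ⊆ Γ′ → Covers G Γ Γ′
    ⊆⇒covers sub e∈ = _ , ε , sub e∈ ∷ []

    -- A backward step is covered by the reversal of the path that covers the forward one.
    covers-edges : ∀ {Γ Γ′} → (∀ {w a u} → (w , a , u) ∈ Γ → ∃[ t ] G ⊢ [ fwd a ] ⇒* t × Path Γ′ w t u) →
                   Covers G Γ Γ′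
    covers-edges h {x = fwd a} e∈ = h e∈
    covers-edges h {x = bwd a} e∈ with h e∈
    ... | t , d , p = barˢ t , Star.gmap barˢ ⇒-bar d , path-bar p

    covers-path : ∀ {Γ Γ′} → Covers G Γ Γ′ → ∀ {w s u} → Path Γ w s u → ∃[ t ] G ⊢ s ⇒* t × Path Γ′ w t u
    covers-path c []       = [] , ε , []
    covers-path c (e ∷ es) with c e | covers-path c es
    ... | t , d , p | t′ , d′ , p′ = t ++ t′ , ⇒*-++ d d′ , p ++ᵖ p′

    -- The letter `x` rewrites to `s`, and the path labelled `s` is itself covered, so the added
    -- edge can be simulated in `Γ′`.
    covers-∷ : ∀ {Γ Γ′ w x u s} → (x ⟶ s) ∈ rules G → Path Γ w s u →
               Covers G Γ Γ′ → Covers G (atom w x u ∷ Γ) Γ′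
    covers-∷ {Γ} {Γ′} {w} {x} {u} p∈ path c = covers-edges edge
      where
      new : ∃[ t ] G ⊢ [ x ] ⇒* t × Path Γ′ w t u
      new with covers-path c path
      ... | t , d , p = t , production p∈ ◅◅ d , p

      forward : ∀ {w a u} x {w′ u′} → (w , a , u) ≡ atom w′ x u′ → ∃[ t ] G ⊢ [ x ] ⇒* t × Path Γ′ w′ t u′ →
                ∃[ t ] G ⊢ [ fwd a ] ⇒* t × Path Γ′ w t u
      forward (fwd _) refl r           = r
      forward (bwd _) refl (t , d , p) = barˢ t , Star.gmap barˢ ⇒-bar d , path-bar p

      edge : ∀ {v b z} → (v , b , z) ∈ atom w x u ∷ Γ → ∃[ t ] G ⊢ [ fwd b ] ⇒* t × Path Γ′ v t z
      edge (here eq)  = forward x eq new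
      edge (there e∈) = c {x = fwd _} e∈

  -- Calculi below an implicit calculus

  module Subsumption (G : ESystem) where

    -- The labels of the left constraint absorb rewriting with G of those of the right one.
    data _⊵_ : ∀ {n} → Constraint n → Constraint n → Set where
      root  : root ⊵ root
      graft : ∀ {n} {C D : Constraint n} {i K H a} → C ⊵ D → rules H ⊆ rules G →
              (∀ {s t} → Lang H a s → G ⊢ s ⇒* t → Lang K a t) →
              graft C i (K , a) ⊵ graft D i (H , a)

    -- Covering turns a path labelled `s` into one whose label is derived from `s` with `G`, which
    -- is just what the labels of `C` absorb.
    satisfies : ∀ {n Γ Γ′} {C D : Constraint n} {ws} → C ⊵ D → Covers G Γ Γ′ →
                Satisfies Γ ws D → Satisfies Γ′ ws C
    satisfies root c _ = _
    satisfies {ws = _ ∷ _} (graft C⊵D _ absorbs) c ((s , d , p) , sat) with covers-path c p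
    ... | t , d′ , p′ = (t , absorbs d d′ , p′) , satisfies C⊵D c sat

    -- Removing productions shrinks the languages of the right constraint, and these occur as
    -- hypotheses of absorption.
    ⊵-fracture : ∀ {n} {C D : Constraint n} K → C ⊵ D → C ⊵ mapᶜ (_∖ᴳ K) D
    ⊵-fracture K root = root
    ⊵-fracture K (graft {H = H} C⊵D sub absorbs) =
      graft (⊵-fracture K C⊵D) (sub ∘ shrink) (absorbs ∘ ⇒*-mono {H ∖ᴳ K} {H} shrink)
      where
      shrink : rules (H ∖ᴳ K) ⊆ rules H
      shrink = proj₁ ∘ ∈-filter⁻ _ {xs = rules H}

    participating-⊆ : ∀ {n} {C D : Constraint n} → C ⊵ D → rules (participating D) ⊆ rules G
    participating-⊆ (graft {D = D} C⊵D sub _) p∈ with ∈-++⁻ (rules (participating D)) p∈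
    ... | inj₁ q = participating-⊆ C⊵D q
    ... | inj₂ q = sub q

    -- A label equal to that of `H ∪ᴳ G` contains every derivation in `H` continued by one in `G`.
    absorbed⇒⊵ : ∀ {n} {C : Constraint n} → rules (participating C) ⊆ rules G →
                 mapᶜ (_∪ᴳ G) C ≈ᶜ C → C ⊵ C
    absorbed⇒⊵ {C = root} sub root = root
    absorbed⇒⊵ {C = graft C i (H , a)} sub (graft C≈ eq) =
      graft (absorbed⇒⊵ (sub ∘ ∈-++⁺ˡ) C≈) (sub ∘ ∈-++⁺ʳ _)
        λ d d′ → to (eq _) (⇒*-mono {H} {H ∪ᴳ G} ∈-++⁺ˡ d ◅◅ ⇒*-mono {G} {H ∪ᴳ G} (∈-++⁺ʳ _) d′)

    data _⊵ᵣ_ : Rule → Rule → Set₁ where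
      initial   : ∀ {n} {C D : Constraint n} {R} → C ⊵ D → initial C R ⊵ᵣ initial D R
      reach     : ∀ {n} {C D : Constraint n} {w u m} {R : Vec (S × S) (suc m) → S × S → Set} →
                  C ⊵ D → reach C w u R ⊵ᵣ reach D w u R
      local     : ∀ {m} {R : Vec S (suc m) → S → Set} → local R ⊵ᵣ local R
      expansion : ∀ {x R} → expansion x R ⊵ᵣ expansion x R

    data HornIn : Rule → Set where
      hornF : ∀ {a s} → (fwd a ⟶ s) ∈ rules G → HornIn (hornF a s)
      hornB : ∀ {a s} → (bwd a ⟶ s) ∈ rules G → HornIn (hornB a s)

    hornRule-in : ∀ {p} → p ∈ rules G → HornIn (hornRule p)
    hornRule-in {fwd a ⟶ s} p∈ = hornF p∈
    hornRule-in {bwd a ⟶ s} p∈ = hornB p∈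

    -- The rules that correspond have the same positions; Horn rules come last.
    infixr 5 _∷_
    data _⊵ᶜ_ : Calculus → Calculus → Set₁ where
      horns : ∀ {𝔅} → All HornIn 𝔅 → [] ⊵ᶜ 𝔅
      _∷_   : ∀ {𝔄 𝔅 ρ σ} → ρ ⊵ᵣ σ → 𝔄 ⊵ᶜ 𝔅 → (ρ ∷ 𝔄) ⊵ᶜ (σ ∷ 𝔅)

    subsuming : ∀ {𝔄 𝔅} → 𝔄 ⊵ᶜ 𝔅 → ∀ {σ} (σ∈ : σ ∈ 𝔅) →
                (∃[ ρ ] Σ[ ρ∈ ∈ ρ ∈ 𝔄 ] toℕ (index ρ∈) ≡ toℕ (index σ∈) × ρ ⊵ᵣ σ) ⊎ HornIn σ
    subsuming (horns hs)  σ∈          = inj₂ (All.lookup hs σ∈)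
    subsuming (ρ⊵σ ∷ _)   (here refl) = inj₁ (_ , here refl , refl , ρ⊵σ)
    subsuming (_ ∷ 𝔄⊵𝔅) (there σ∈) with subsuming 𝔄⊵𝔅 σ∈
    ... | inj₁ (ρ , ρ∈ , eq , ρ⊵σ) = inj₁ (ρ , there ρ∈ , cong suc eq , ρ⊵σ)
    ... | inj₂ h                    = inj₂ h

    ⊵ᵣ-fracture : ∀ {ρ σ} K → ρ ⊵ᵣ σ → ρ ⊵ᵣ (σ ⊖ K)
    ⊵ᵣ-fracture K (initial c) = initial (⊵-fracture K c)
    ⊵ᵣ-fracture K (reach c)   = reach (⊵-fracture K c)
    ⊵ᵣ-fracture K local       = local
    ⊵ᵣ-fracture K expansion   = expansion

    horn-fracture : ∀ {σ} K → HornIn σ → HornIn (σ ⊖ K)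
    horn-fracture K (hornF p∈) = hornF p∈
    horn-fracture K (hornB p∈) = hornB p∈

    -- `fracture` works position by position and appends its Horn rules, so it only lengthens the
    -- tail kept in `horns`.
    ⊵ᶜ-fracture : ∀ {𝔄 𝔅} P → P ⊆ rules G → 𝔄 ⊵ᶜ 𝔅 → 𝔄 ⊵ᶜ fracture 𝔅 P
    ⊵ᶜ-fracture P P⊆G = go
      where
      go : ∀ {𝔄 𝔅} → 𝔄 ⊵ᶜ 𝔅 → 𝔄 ⊵ᶜ fracture 𝔅 P
      go (horns hs) = horns (All.++⁺ (All.map⁺ (All.map (horn-fracture G⟨ P ⟩) hs))
                                     (All.map⁺ (All.tabulate (hornRule-in ∘ P⊆G))))
      go (ρ⊵σ ∷ 𝔄⊵𝔅) = ⊵ᵣ-fracture G⟨ P ⟩ ρ⊵σ ∷ go 𝔄⊵𝔅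

    Gᵣ-⊆ : ∀ {ρ σ} → ρ ⊵ᵣ σ → rules (Gᵣ σ) ⊆ rules G
    Gᵣ-⊆ (initial c) = participating-⊆ c
    Gᵣ-⊆ (reach c)   = participating-⊆ c
    Gᵣ-⊆ local       ()
    Gᵣ-⊆ expansion   ()

  ∈-Gᶜ⁺ : ∀ {𝔄 ρ p} → ρ ∈ 𝔄 → p ∈ rules (Gᵣ ρ) → p ∈ rules (Gᶜ 𝔄)
  ∈-Gᶜ⁺ (here refl)             p∈ = ∈-++⁺ˡ p∈
  ∈-Gᶜ⁺ {𝔄 = σ ∷ _} (there ρ∈) p∈ = ∈-++⁺ʳ (rules (Gᵣ σ)) (∈-Gᶜ⁺ ρ∈ p∈)

  ∈-Gᶜ⁻ : ∀ 𝔄 {p} → p ∈ rules (Gᶜ 𝔄) → ∃[ ρ ] ρ ∈ 𝔄 × p ∈ rules (Gᵣ ρ)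
  ∈-Gᶜ⁻ (ρ ∷ 𝔄) p∈ with ∈-++⁻ (rules (Gᵣ ρ)) p∈
  ... | inj₁ q = ρ , here refl , q
  ... | inj₂ q with ∈-Gᶜ⁻ 𝔄 q
  ...   | σ , σ∈ , r = σ , there σ∈ , r

  ∈ₚ⇒∈ : ∀ G {p} → p ∈ₚ rules G → p ∈ rules G
  ∈ₚ⇒∈ G p∈ with find p∈
  ... | q , q∈ , inj₁ refl = q∈
  ... | q , q∈ , inj₂ refl = to (closed G q) q∈

  module _ (𝔄 : Calculus) (implicit : Implicit 𝔄) where
    open Subsumption (Gᶜ 𝔄)

    ≈ᶜ-refl : ∀ {n} (C : Constraint n) → C ≈ᶜ C
    ≈ᶜ-refl root = root
    ≈ᶜ-refl (graft C i (G , a)) = graft (≈ᶜ-refl C) λ t → ⇔-id (Lang G a t)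

    -- Stated with equations because the indices ρ ⊕ G and ρ of _≈ᵣ_ do not unify.
    initial-≈ : ∀ {n} {C D : Constraint n} {R R′ ρ σ} → ρ ≈ᵣ σ → ρ ≡ initial C R → σ ≡ initial D R′ → C ≈ᶜ D
    initial-≈ {C = C} same refl refl = ≈ᶜ-refl C
    initial-≈ (initial eq)  refl refl = eq

    reach-≈ : ∀ {n} {C D : Constraint n} {w u w′ u′ m} {R R′ : Vec (S × S) (suc m) → S × S → Set} {ρ σ} →
              ρ ≈ᵣ σ → ρ ≡ reach C w u R → σ ≡ reach D w′ u′ R′ → C ≈ᶜ D
    reach-≈ {C = C} same refl refl = ≈ᶜ-refl C
    reach-≈ (reach eq)   refl refl = eq

    implicit-⊵ᵣ : ∀ ρ → ρ ∈ 𝔄 → ρ ⊵ᵣ ρ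
    implicit-⊵ᵣ (initial C R)   ρ∈ =
      initial (absorbed⇒⊵ (∈-Gᶜ⁺ ρ∈) (initial-≈ (proj₂ implicit _ ρ∈ initial) refl refl))
    implicit-⊵ᵣ (reach C w u R) ρ∈ =
      reach (absorbed⇒⊵ (∈-Gᶜ⁺ ρ∈) (reach-≈ (proj₂ implicit _ ρ∈ reach) refl refl))
    implicit-⊵ᵣ (local R)       ρ∈ = local
    implicit-⊵ᵣ (expansion x R) ρ∈ = expansion
    implicit-⊵ᵣ (hornF a s)     ρ∈ = contradiction hornF (proj₁ implicit _ ρ∈)
    implicit-⊵ᵣ (hornB a s)     ρ∈ = contradiction hornB (proj₁ implicit _ ρ∈)

    -- Each non-Horn rule of `𝔅` corresponds to one of `𝔄`, and correspondence confines its
    -- productions to `Gᶜ 𝔄`.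
    Gᶜ-∖Horn-⊆ : ∀ {𝔅} → 𝔄 ⊵ᶜ 𝔅 → rules (Gᶜ (𝔅 ∖Horn)) ⊆ rules (Gᶜ 𝔄)
    Gᶜ-∖Horn-⊆ {𝔅} 𝔄⊵𝔅 p∈ with ∈-Gᶜ⁻ (𝔅 ∖Horn) p∈
    ... | σ , σ∈ , q with ∈-filter⁻ (¬? ∘ isHorn?) {xs = 𝔅} σ∈
    ...   | σ∈𝔅 , ¬horn with subsuming 𝔄⊵𝔅 σ∈𝔅
    ...     | inj₁ (_ , _ , _ , ρ⊵σ) = Gᵣ-⊆ ρ⊵σ q
    ...     | inj₂ (hornF _)          = contradiction hornF ¬horn
    ...     | inj₂ (hornB _)          = contradiction hornB ¬horn

    -- Induction along the downward space: the pairs fractured off come from the grammar of the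
    -- non-Horn rules, hence the new Horn rules express productions of `Gᶜ 𝔄`.
    downward-⊵ᶜ : ∀ {𝔅} → 𝐒 𝔄 𝔅 → 𝔄 ⊵ᶜ 𝔅
    downward-⊵ᶜ top = go implicit-⊵ᵣ
      where
      go : ∀ {𝔅} → (∀ ρ → ρ ∈ 𝔅 → ρ ⊵ᵣ ρ) → 𝔅 ⊵ᶜ 𝔅
      go {[]}    h = horns []
      go {ρ ∷ 𝔅} h = h ρ (here refl) ∷ go (λ σ → h σ ∘ there)
    downward-⊵ᶜ (down {𝔅 = 𝔅} s (fractures P P⊆ _)) with downward-⊵ᶜ s
    ... | 𝔄⊵𝔅 = ⊵ᶜ-fracture P
      (λ p∈ → Gᶜ-∖Horn-⊆ 𝔄⊵𝔅 (∈ₚ⇒∈ (Gᶜ (𝔅 ∖Horn)) (P⊆ (lose p∈ (inj₁ refl))))) 𝔄⊵𝔅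

  -- Deleting Horn inferences

  ≋-refl : ∀ {A : Set} {xs : List A} → xs ≋ xs
  ≋-refl = id , id

  ≋-sym : ∀ {A : Set} {xs ys : List A} → xs ≋ ys → ys ≋ xs
  ≋-sym (p , q) = q , p

  ≋-trans : ∀ {A : Set} {xs ys zs : List A} → xs ≋ ys → ys ≋ zs → xs ≋ zs
  ≋-trans (p , q) (p′ , q′) = p′ ∘ p , q ∘ q′

  V-⊆ : ∀ {G H} → Δ G ⊆ Δ H → V G ⊆ V H
  V-⊆ = ⊆.map⁺ proj₁

  atom-endpoints : ∀ {w x u v a z} → (v , a , z) ≡ atom w x u → u ≡ v ⊎ u ≡ z
  atom-endpoints {x = fwd _} refl = inj₂ refl
  atom-endpoints {x = bwd _} refl = inj₁ refl

  -- The codes of applications other than Horn rules, with the edges they introduce.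
  data Shape : Tree → List Edge → Set where
    plain     : ∀ {r} (k : Fin 3) → Shape (node (codeℕ (toℕ k)) r) []
    expanding : ∀ {w u e r} → Shape (node (codeℕ 3) (node w (node u (node (codeEdge e) r)))) [ e ]

  data HornShape : Tree → Set where
    forward  : ∀ {r} → HornShape (node (codeℕ 4) r)
    backward : ∀ {r} → HornShape (node (codeℕ 5) r)

  module Elimination (G : ESystem) (𝔄 𝔅 : Calculus) where
    open Subsumption G

    -- `Q` is `H` without the edges added by deleted Horn inferences; `covers` lets constraints
    -- survive their loss.
    record Restricts (Q H : GSequent) : Set where
      field
        edges  : Γ Q ⊆ Γ H
        labels : Δ Q ≋ Δ H
        covers : Covers G (Γ H) (Γ Q)
    open Restricts public

    -- An application of ρ with conclusion Q that restricts α.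
    record Step {σ Hs H} (α : Application σ Hs H) (ρ : Rule) (Q : GSequent) : Set₁ where
      field
        same-arity       : arity ρ ≡ arity σ
        new              : List Edge
        premises         : Vec GSequent (arity ρ)
        application      : Application ρ premises Q
        shape            : Shape (codeApplication α) new
        same-code        : codeApplication application ≡ codeApplication α
        same-introduced  : introduced application ≡ introduced α
        new-introduced   : ∀ {w a u} → (w , a , u) ∈ new → w ∈ introduced α ⊎ u ∈ introduced α
      source : Fin (arity ρ) → Fin (arity σ)
      source = subst Fin same-arity
      field
        premise-edges     : ∀ i → Γ (lookup premises i) ≡ new ++ Γ Q
        premise-labels    : ∀ i → Δ (lookup premises i) ≡ Δ (lookup Hs (source i))
        premise-restricts : ∀ i → Restricts (lookup premises i) (lookup Hs (source i))

    -- The graph of `eliminate`, on which freshness, size and running time are proved by induction.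
    -- In `skip` the equation of codes expresses that there is one subproof, without fixing the rule
    -- `σ`.
    data Elim : ∀ {H Q} → ProofTree 𝔅 H → ProofTree 𝔄 Q → Set₁ where
      skip : ∀ {σ Hs H Q} {σ∈ : σ ∈ 𝔅} {α : Application σ Hs H} {ps} {P : ProofTree 𝔄 Q} (i : Fin (arity σ)) →
             HornShape (codeApplication α) →
             List.tabulate (λ j → codeTree (ps j)) ≡ [ codeTree (ps i) ] →
             Restricts Q H →
             Elim (ps i) P →
             Elim (infer σ∈ α ps) P
      keep : ∀ {σ ρ Hs H Q} {σ∈ : σ ∈ 𝔅} {ρ∈ : ρ ∈ 𝔄} {α : Application σ Hs H} {ps} (step : Step α ρ Q) →
             (let open Step step) → ∀ {qs} →
             toℕ (index ρ∈) ≡ toℕ (index σ∈) →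
             Restricts Q H →
             (∀ i → Elim (ps (source i)) (qs i)) →
             Elim (infer σ∈ α ps) (infer ρ∈ application qs)

    -- Edges are computed from the conclusion `Q`, not by filtering premises, and label lists are
    -- copied, so the premises agree with the program's output even as lists.
    module Premises {n} (Hs : Vec GSequent n) {H Q : GSequent} (r : Restricts Q H) (new : List Edge)
                    (unique : Unique (new ++ Γ Q)) (grow : ∀ i → Γ (lookup Hs i) ≋ new ++ Γ H) where

      grown : ∀ i → new ++ Γ Q ⊆ Γ (lookup Hs i)
      grown i = proj₂ (grow i) ∘ ⊆.++⁺ʳ new (edges r)

      premise : Fin n → GSequent
      premise i = record
        { Γ        = new ++ Γ Q
        ; Δ        = Δ (lookup Hs i)
        ; Γ-unique = unique
        ; Δ-unique = Δ-unique (lookup Hs i)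
        ; Γ-on-V   = All.tabulate (All.lookup (Γ-on-V (lookup Hs i)) ∘ grown i)
        }

      premise-covers : ∀ i → Covers G (Γ (lookup Hs i)) (new ++ Γ Q)
      premise-covers i {x = x} e∈ with ∈-++⁻ new (proj₁ (grow i) e∈)
      ... | inj₁ e∈new = ⊆⇒covers {G} ∈-++⁺ˡ {x = x} e∈new
      ... | inj₂ e∈H with covers r {x = x} e∈H
      ...   | t , d , p = t , d , path-mono (∈-++⁺ʳ new) p

      premises : Vec GSequent n
      premises = tabulate premise

      -- Lookup in a tabulated vector does not reduce at a variable index, so facts about `premise`
      -- are transported.
      on-premises : (P : Fin n → GSequent → Set) → (∀ i → P i (premise i)) → ∀ i → P i (lookup premises i)
      on-premises P h i = subst (P i) (sym (lookup∘tabulate premise i)) (h i)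

      premise-edges : ∀ i → Γ (lookup premises i) ≡ new ++ Γ Q
      premise-edges = on-premises (λ _ K → Γ K ≡ new ++ Γ Q) λ _ → refl

      premise-labels : ∀ i → Δ (lookup premises i) ≡ Δ (lookup Hs i)
      premise-labels = on-premises (λ i K → Δ K ≡ Δ (lookup Hs i)) λ _ → refl

      premise-restricts : ∀ i → Restricts (lookup premises i) (lookup Hs i)
      premise-restricts = on-premises (λ i K → Restricts K (lookup Hs i)) λ i →
        record { edges = grown i ; labels = ≋-refl ; covers = premise-covers i }

      premises-≐ : ∀ {B : Set} {xs : Vec B n} {Γ′} {Δ′ : B → List Prefixed} → Γ′ ≡ new ++ Γ Q →
                   Pointwise (λ H′ x → H′ ≐ new ++ Γ H ⊢ Δ′ x) Hs xs →
                   Pointwise (λ H′ x → H′ ≐ Γ′ ⊢ Δ′ x) premises xs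
      premises-≐ {xs = xs} {Δ′ = Δ′} refl pw =
        extensional⇒inductive (ext (on-premises (λ i K → K ≐ new ++ Γ Q ⊢ Δ′ (lookup xs i)) λ i →
          ≋-refl , proj₂ (Pointwise.lookup pw i)))

    conclusion-≐ : ∀ {Q H Δ′} → Restricts Q H → H ≐ Γ H ⊢ Δ′ → Q ≐ Γ Q ⊢ Δ′
    conclusion-≐ r (_ , Δ≋) = ≋-refl , ≋-trans (labels r) Δ≋

    step : ∀ {σ ρ Hs H Q} → ρ ⊵ᵣ σ → (α : Application σ Hs H) → Restricts Q H → Step α ρ Q
    step {Q = Q} (initial c) (initial Δ′ ws Ss H≐ sat R) r = record
      { same-arity        = refl
      ; new               = []
      ; premises          = premises
      ; application       = initial Δ′ ws Ss (conclusion-≐ r H≐) (satisfies c (covers r) sat) R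
      ; shape             = plain zero
      ; same-code         = refl
      ; same-introduced   = refl
      ; new-introduced    = λ ()
      ; premise-edges     = premise-edges
      ; premise-labels    = premise-labels
      ; premise-restricts = premise-restricts
      }
      where open Premises [] r [] (Γ-unique Q) (λ ())
    step {Hs = Hs} {H} {Q} (reach c) (reach Δ′ vs Ss T T′ Hs≐ H≐ vs∈ sat R) r = record
      { same-arity        = refl
      ; new               = []
      ; premises          = premises
      ; application       = reach Δ′ vs Ss T T′ (premises-≐ refl Hs≐) (conclusion-≐ r H≐)
                              (All.map (V-⊆ {H} {Q} (proj₂ (labels r))) vs∈) (satisfies c (covers r) sat) R
      ; shape             = plain (suc zero)
      ; same-code         = refl
      ; same-introduced   = refl
      ; new-introduced    = λ ()
      ; premise-edges     = premise-edges
      ; premise-labels    = premise-labels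
      ; premise-restricts = premise-restricts
      }
      where open Premises Hs r [] (Γ-unique Q) (proj₁ ∘ Pointwise.lookup Hs≐)
    step {Hs = Hs} {Q = Q} local (local Δ′ w Ss T Hs≐ H≐ R) r = record
      { same-arity        = refl
      ; new               = []
      ; premises          = premises
      ; application       = local Δ′ w Ss T (premises-≐ refl Hs≐) (conclusion-≐ r H≐) R
      ; shape             = plain (suc (suc zero))
      ; same-code         = refl
      ; same-introduced   = refl
      ; new-introduced    = λ ()
      ; premise-edges     = premise-edges
      ; premise-labels    = premise-labels
      ; premise-restricts = premise-restricts
      }
      where open Premises Hs r [] (Γ-unique Q) (proj₁ ∘ Pointwise.lookup Hs≐)
    step {Hs = Hs} {H} {Q} (expansion {x}) (expansion Δ′ w u S₁ S₂ T u∉ H₁≐ H≐ R) r = record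
      { same-arity        = refl
      ; new               = [ atom w x u ]
      ; premises          = premises
      ; application       = expansion Δ′ w u S₁ S₂ T (u∉ ∘ V-⊆ {Q} {H} (proj₁ (labels r)))
                              (≋-refl , proj₂ H₁≐) (conclusion-≐ r H≐) R
      ; shape             = expanding
      ; same-code         = refl
      ; same-introduced   = refl
      ; new-introduced    = λ { (here eq) → introduced-end eq }
      ; premise-edges     = premise-edges
      ; premise-labels    = premise-labels
      ; premise-restricts = premise-restricts
      }
      where
      introduced-end : ∀ {v a z} → (v , a , z) ≡ atom w x u → v ∈ [ u ] ⊎ z ∈ [ u ]
      introduced-end eq with atom-endpoints {x = x} eq
      ... | inj₁ refl = inj₁ (here refl)
      ... | inj₂ refl = inj₂ (here refl)

      -- Edges of `H` have both ends in `V H`, which omits `u`; hence prepending the new atom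
      -- creates no duplicate.
      unused : ∀ {e} → e ∈ Γ H → atom w x u ≢ e
      unused {v , a , z} e∈ eq with All.lookup (Γ-on-V H) e∈ | atom-endpoints {x = x} (sym eq)
      ... | v∈ , z∈ | inj₁ refl = u∉ v∈
      ... | v∈ , z∈ | inj₂ refl = u∉ z∈

      premise-≋ : ∀ i → Γ (lookup Hs i) ≋ atom w x u ∷ Γ H
      premise-≋ zero = proj₁ H₁≐

      open Premises Hs r [ atom w x u ] (All.tabulate (unused ∘ edges r) ∷ Γ-unique Q) premise-≋

    -- `Q` stays fixed while `H` gains an edge: the chain required by the Horn rule covers that
    -- edge.
    restricts-horn : ∀ {Q H H₁ w x u s} → (x ⟶ s) ∈ rules G → Path (Γ H) w s u →
                     H₁ ≐ atom w x u ∷ Γ H ⊢ Δ H → Restricts Q H → Restricts Q H₁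
    restricts-horn p∈ path (Γ≋ , Δ≋) r = record
      { edges  = proj₂ Γ≋ ∘ there ∘ edges r
      ; labels = ≋-trans (labels r) (≋-sym Δ≋)
      ; covers = λ {_} {x} e∈ → covers-∷ {G} p∈ path (covers r) {x = x} (proj₁ Γ≋ e∈)
      }

    eliminate : 𝔄 ⊵ᶜ 𝔅 → ∀ {H Q} (P : ProofTree 𝔅 H) → Restricts Q H → ∃[ P′ ] Elim {Q = Q} P P′
    eliminate 𝔄⊵𝔅 (infer σ∈ α ps) r with subsuming 𝔄⊵𝔅 σ∈
    ... | inj₁ (ρ , ρ∈ , eq , ρ⊵σ) =
      infer ρ∈ application (λ i → proj₁ (rec i)) , keep stp eq r (λ i → proj₂ (rec i))
      where
      stp = step ρ⊵σ α r
      open Step stp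
      rec : ∀ i → ∃[ P′ ] Elim (ps (source i)) P′
      rec i = eliminate 𝔄⊵𝔅 (ps (source i)) (premise-restricts i)
    eliminate 𝔄⊵𝔅 (infer σ∈ (hornF w u path H≐) ps) r | inj₂ (hornF p∈)
      with eliminate 𝔄⊵𝔅 (ps zero) (restricts-horn {x = fwd _} p∈ path H≐ r)
    ... | P′ , e = P′ , skip zero forward refl r e
    eliminate 𝔄⊵𝔅 (infer σ∈ (hornB w u path H≐) ps) r | inj₂ (hornB p∈)
      with eliminate 𝔄⊵𝔅 (ps zero) (restricts-horn {x = bwd _} p∈ path H≐ r)
    ... | P′ , e = P′ , skip zero backward refl r e

  -- Freshness and size

  V-≋ : ∀ {H Δ′} → Δ H ≋ Δ′ → V H ≋ map proj₁ Δ′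
  V-≋ (p , q) = ⊆.map⁺ proj₁ p , ⊆.map⁺ proj₁ q

  premise-V : ∀ {ρ Hs H} → Application ρ Hs H → ∀ i → V H ⊆ V (lookup Hs i)
  premise-V {Hs = Hs} {H} (reach _ vs Ss T T′ Hs≐ (_ , Δ≋) _ _ _) i =
    proj₂ (V-≋ {lookup Hs i} (proj₂ (Pointwise.lookup Hs≐ i))) ∘ proj₁ (V-≋ {H} Δ≋)
  premise-V {Hs = Hs} {H} (local _ w Ss T Hs≐ (_ , Δ≋) _) i =
    proj₂ (V-≋ {lookup Hs i} (proj₂ (Pointwise.lookup Hs≐ i))) ∘ proj₁ (V-≋ {H} Δ≋)
  premise-V {Hs = H₁ ∷ []} {H} (expansion _ w u _ _ _ _ (_ , Δ₁≋) (_ , Δ≋) _) zero =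
    proj₂ (V-≋ {H₁} Δ₁≋) ∘ (λ { (here p) → here p ; (there p) → there (there p) }) ∘ proj₁ (V-≋ {H} Δ≋)
  premise-V {Hs = H₁ ∷ []} (hornF _ _ _ (_ , Δ≋)) zero = proj₂ (V-≋ {H₁} Δ≋)
  premise-V {Hs = H₁ ∷ []} (hornB _ _ _ (_ , Δ≋)) zero = proj₂ (V-≋ {H₁} Δ≋)

  introduced-∉ : ∀ {ρ Hs H} (α : Application ρ Hs H) {v} → v ∈ introduced α → v ∉ V H
  introduced-∉ (expansion _ w u _ _ _ u∉ _ _ _) (here refl) = u∉

  module _ {𝔅 : Calculus} where

    -- An eigenvertex is absent from the conclusion of its expansion, and vertices are never lost
    -- going upwards, so it is absent from everything below as well.
    eigenvertices-∉ : ∀ {H} (P : ProofTree 𝔅 H) {v} → v ∈ eigenvertices P → v ∉ V H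
    eigenvertices-∉ (infer _ α ps) v∈ with ∈-++⁻ (introduced α) v∈
    ... | inj₁ v∈α  = introduced-∉ α v∈α
    ... | inj₂ v∈ps with ∈-concat-tabulate⁻ (λ i → eigenvertices (ps i)) v∈ps
    ...   | i , v∈i = eigenvertices-∉ (ps i) v∈i ∘ premise-V α i

    eigenvertices-child : ∀ {σ Hs H} {σ∈ : σ ∈ 𝔅} {α : Application σ Hs H} {ps} i →
                          eigenvertices (ps i) ⊆ eigenvertices (infer σ∈ α ps)
    eigenvertices-child {α = α} {ps} i v∈ =
      ∈-++⁺ʳ (introduced α) (∈-concat-tabulate⁺ (λ j → eigenvertices (ps j)) i v∈)

    sequents-child : ∀ {σ Hs H} {σ∈ : σ ∈ 𝔅} {α : Application σ Hs H} {ps} i →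
                     sequents (ps i) ⊆ sequents (infer σ∈ α ps)
    sequents-child {ps = ps} i H∈ = there (∈-concat-tabulate⁺ (λ j → sequents (ps j)) i H∈)

    ∈-verticesOf⁺ : ∀ {H H′} (P : ProofTree 𝔅 H) → H′ ∈ sequents P → V H′ ⊆ verticesOf P
    ∈-verticesOf⁺ P H′∈ v∈ = Any.concat⁺ (Any.map⁺ (lose H′∈ v∈))

    ∈-verticesOf⁻ : ∀ {H} (P : ProofTree 𝔅 H) {v} → v ∈ verticesOf P → ∃[ H′ ] H′ ∈ sequents P × v ∈ V H′
    ∈-verticesOf⁻ P v∈ = find (Any.map⁻ (Any.concat⁻ (map V (sequents P)) v∈))

  ≈-refl : ∀ {H} → H ≈ H
  ≈-refl = ≋-refl , ≋-refl

  ≈-sym : ∀ {H K} → H ≈ K → K ≈ H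
  ≈-sym (p , q) = ≋-sym p , ≋-sym q

  ≈-trans : ∀ {H K L} → H ≈ K → K ≈ L → H ≈ L
  ≈-trans (p , q) (p′ , q′) = ≋-trans p p′ , ≋-trans q q′

  module _ {G : ESystem} {𝔄 𝔅 : Calculus} where
    open Elimination G 𝔄 𝔅

    eliminated-eigenvertices : ∀ {H Q} {P : ProofTree 𝔅 H} {P′ : ProofTree 𝔄 Q} → Elim P P′ →
                               eigenvertices P′ ⊆ eigenvertices P
    eliminated-eigenvertices (skip {σ∈ = σ∈} {α} {ps} i _ _ _ d) =
      eigenvertices-child {σ∈ = σ∈} {α} {ps} i ∘ eliminated-eigenvertices d
    eliminated-eigenvertices (keep {σ∈ = σ∈} {α = α} {ps} step {qs} _ _ ds) v∈
      with ∈-++⁻ (introduced (Step.application step)) v∈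
    ... | inj₁ v∈α = ∈-++⁺ˡ (subst (_ ∈_) (Step.same-introduced step) v∈α)
    ... | inj₂ v∈qs with ∈-concat-tabulate⁻ (λ i → eigenvertices (qs i)) v∈qs
    ...   | i , v∈i = eigenvertices-child {σ∈ = σ∈} {α} {ps} (Step.source step i) (eliminated-eigenvertices (ds i) v∈i)

    -- Q′ is what remains of H′ at some position of the proof.
    Aligned : ∀ {H Q} {P : ProofTree 𝔅 H} {P′ : ProofTree 𝔄 Q} → Elim P P′ → GSequent → GSequent → Set
    -- Conclusion and premise of a deleted inference leave the same `Q`, which is matched with a
    -- g-sequent further up.
    Aligned (skip _ _ _ _ d)            H′ Q′ = Aligned d H′ Q′
    Aligned (keep {H = H} {Q} _ _ _ ds) H′ Q′ = (H′ ≡ H × Q′ ≡ Q) ⊎ ∃[ i ] Aligned (ds i) H′ Q′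

    aligned-source : ∀ {H Q} {P : ProofTree 𝔅 H} {P′ : ProofTree 𝔄 Q} (d : Elim P P′) {H′ Q′} →
                     Aligned d H′ Q′ → H′ ∈ sequents P
    aligned-source (skip {σ∈ = σ∈} {α} {ps} i _ _ _ d) a =
      sequents-child {σ∈ = σ∈} {α} {ps} i (aligned-source d a)
    aligned-source (keep _ _ _ ds) (inj₁ (refl , refl)) = here refl
    aligned-source (keep {σ∈ = σ∈} {α = α} {ps} step _ _ ds) (inj₂ (i , a)) =
      sequents-child {σ∈ = σ∈} {α} {ps} (Step.source step i) (aligned-source (ds i) a)

    aligned-restricts : ∀ {H Q} {P : ProofTree 𝔅 H} {P′ : ProofTree 𝔄 Q} (d : Elim P P′) {H′ Q′} →
                        Aligned d H′ Q′ → Restricts Q′ H′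
    aligned-restricts (skip _ _ _ _ d) a                    = aligned-restricts d a
    aligned-restricts (keep _ _ r _)   (inj₁ (refl , refl)) = r
    aligned-restricts (keep _ _ _ ds)  (inj₂ (i , a))       = aligned-restricts (ds i) a

    aligned-target : ∀ {H Q} {P : ProofTree 𝔅 H} {P′ : ProofTree 𝔄 Q} (d : Elim P P′) {Q′} →
                     Q′ ∈ sequents P′ → ∃[ H′ ] Aligned d H′ Q′
    aligned-target (skip _ _ _ _ d) Q′∈              = aligned-target d Q′∈
    aligned-target (keep _ _ _ ds)  (here refl)      = _ , inj₁ (refl , refl)
    aligned-target (keep _ {qs} _ _ ds) (there Q′∈) with ∈-concat-tabulate⁻ (λ i → sequents (qs i)) Q′∈
    ... | i , Q′∈i with aligned-target (ds i) Q′∈i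
    ...   | H′ , a = H′ , inj₂ (i , a)

    eliminated-vertices : ∀ {H Q} {P : ProofTree 𝔅 H} {P′ : ProofTree 𝔄 Q} → Elim P P′ →
                          verticesOf P′ ⊆ verticesOf P
    eliminated-vertices {P = P} {P′} d v∈ with ∈-verticesOf⁻ P′ v∈
    ... | Q′ , Q′∈ , v∈Q′ with aligned-target d Q′∈
    ...   | H′ , a = ∈-verticesOf⁺ P (aligned-source d a)
                       (V-⊆ {Q′} {H′} (proj₁ (labels (aligned-restricts d a))) v∈Q′)

    eliminated-fresh : ∀ {H Q} {P : ProofTree 𝔅 H} {P′ : ProofTree 𝔄 Q} → Elim P P′ → Fresh P → Fresh P′
    eliminated-fresh (skip i _ _ _ d)   (fresh , _)        = eliminated-fresh d (fresh i)
    eliminated-fresh (keep step _ _ ds) (fresh , disjoint) =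
      (λ i → eliminated-fresh (ds i) (fresh (source i))) ,
      λ i j i≢j (v∈i , v∈j) →
        disjoint (source i) (source j) (i≢j ∘ subst-injective same-arity)
          (eliminated-eigenvertices (ds i) v∈i , eliminated-vertices (ds j) v∈j)
      where open Step step

    -- An expansion may direct its edge either way, so its eigenvertex may be either end.
    Meets : Edge → List Vertex → Set
    Meets (w , _ , u) vs = w ∈ vs ⊎ u ∈ vs

    Meets-mono : ∀ {e vs vs′} → vs ⊆ vs′ → Meets e vs → Meets e vs′
    Meets-mono sub (inj₁ w∈) = inj₁ (sub w∈)
    Meets-mono sub (inj₂ u∈) = inj₂ (sub u∈)

    Meets-apart : ∀ H {e vs} → e ∈ Γ H → (∀ {v} → v ∈ vs → v ∉ V H) → ¬ Meets e vs
    Meets-apart H e∈ apart (inj₁ w∈) = apart w∈ (proj₁ (All.lookup (Γ-on-V H) e∈))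
    Meets-apart H e∈ apart (inj₂ u∈) = apart u∈ (proj₂ (All.lookup (Γ-on-V H) e∈))

    aligned-⊇ : ∀ {H Q} {P : ProofTree 𝔅 H} {P′ : ProofTree 𝔄 Q} (d : Elim P P′) {H′ Q′} →
                Aligned d H′ Q′ → Γ Q ⊆ Γ Q′
    aligned-⊇ (skip _ _ _ _ d)   a                    = aligned-⊇ d a
    aligned-⊇ (keep _ _ _ _)     (inj₁ (refl , refl)) = id
    aligned-⊇ (keep step _ _ ds) (inj₂ (i , a))       =
      aligned-⊇ (ds i) a ∘ subst (_ ∈_) (sym (Step.premise-edges step i)) ∘ ∈-++⁺ʳ (Step.new step)

    -- An edge not present at the root entered through some expansion, together with its
    -- eigenvertex.
    aligned-edges : ∀ {H Q} {P : ProofTree 𝔅 H} {P′ : ProofTree 𝔄 Q} (d : Elim P P′) {H′ Q′ e} →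
                    Aligned d H′ Q′ → e ∈ Γ Q′ → e ∈ Γ Q ⊎ Meets e (eigenvertices P)
    aligned-edges (skip {σ∈ = σ∈} {α} {ps} i _ _ _ d) {e = e} a e∈ with aligned-edges d a e∈
    ... | inj₁ e∈Q = inj₁ e∈Q
    ... | inj₂ m   = inj₂ (Meets-mono {e} (eigenvertices-child {σ∈ = σ∈} {α} {ps} i) m)
    aligned-edges (keep _ _ _ _) (inj₁ (refl , refl)) e∈ = inj₁ e∈
    aligned-edges (keep {σ∈ = σ∈} {α = α} {ps} step _ _ ds) {e = e} (inj₂ (i , a)) e∈ with aligned-edges (ds i) a e∈
    ... | inj₂ m = inj₂ (Meets-mono {e} (eigenvertices-child {σ∈ = σ∈} {α} {ps} (Step.source step i)) m)
    ... | inj₁ e∈i with ∈-++⁻ (Step.new step) (subst (_ ∈_) (Step.premise-edges step i) e∈i)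
    ...   | inj₁ e∈new = inj₂ (Meets-mono {e} ∈-++⁺ˡ (Step.new-introduced step e∈new))
    ...   | inj₂ e∈Q   = inj₁ e∈Q

    -- An edge of Q₁ that Q₂ lacks was introduced by an expansion on the branch of Q₁ only, together
    -- with a vertex that by freshness does not occur in H₂, whereas it occurs in H₁.
    aligned-⊆ : ∀ {H Q} {P : ProofTree 𝔅 H} {P′ : ProofTree 𝔄 Q} (d : Elim P P′) → Fresh P →
                ∀ {H₁ Q₁ H₂ Q₂} → Aligned d H₁ Q₁ → Aligned d H₂ Q₂ → H₁ ≈ H₂ → Γ Q₁ ⊆ Γ Q₂
    aligned-⊆ (skip i _ _ _ d) (fresh , _) a₁ a₂ eq = aligned-⊆ d (fresh i) a₁ a₂ eq
    aligned-⊆ d@(keep _ _ _ _) _ (inj₁ (refl , refl)) a₂ eq = aligned-⊇ d a₂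
    aligned-⊆ {P = P} d@(keep _ _ _ _) _ {H₁} {H₂ = H₂} a₁@(inj₂ _) (inj₁ (refl , refl)) eq e∈
      with aligned-edges d a₁ e∈
    ... | inj₁ e∈Q = e∈Q
    -- Here `H₂` is the conclusion of the whole subproof, in which no eigenvertex occurs.
    ... | inj₂ m   = contradiction m (Meets-apart H₂ (proj₁ (proj₁ eq) (edges (aligned-restricts d a₁) e∈))
                                       (eigenvertices-∉ P))
    aligned-⊆ (keep {ps = ps} step _ _ ds) (fresh , disjoint) {H₂ = H₂} {Q₂} (inj₂ (i , a₁)) (inj₂ (j , a₂)) eq {e} e∈
      with i Fin.≟ j
    ... | yes refl = aligned-⊆ (ds i) (fresh (Step.source step i)) a₁ a₂ eq e∈
    ... | no i≢j with aligned-edges (ds i) a₁ e∈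
    -- All premises of a kept step have the same edges, so `e` is also available on the other
    -- branch.
    ...   | inj₁ e∈i = aligned-⊇ (ds j) a₂
                         (subst (e ∈_) (trans (Step.premise-edges step i) (sym (Step.premise-edges step j))) e∈i)
    ...   | inj₂ m   = contradiction m
      (Meets-apart H₂ (proj₁ (proj₁ eq) (edges (aligned-restricts (ds i) a₁) e∈)) λ v∈ v∈₂ →
        disjoint (Step.source step i) (Step.source step j) (i≢j ∘ subst-injective (Step.same-arity step))
          (v∈ , ∈-verticesOf⁺ (ps (Step.source step j)) (aligned-source (ds j) a₂) v∈₂))

    aligned-≈ : ∀ {H Q} {P : ProofTree 𝔅 H} {P′ : ProofTree 𝔄 Q} (d : Elim P P′) → Fresh P →
                ∀ {H₁ Q₁ H₂ Q₂} → Aligned d H₁ Q₁ → Aligned d H₂ Q₂ → H₁ ≈ H₂ → Q₁ ≈ Q₂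
    aligned-≈ d fresh {H₁} {Q₁} {H₂} {Q₂} a₁ a₂ eq =
      (aligned-⊆ d fresh a₁ a₂ eq , aligned-⊆ d fresh a₂ a₁ (≈-sym {H₁} {H₂} eq)) ,
      ≋-trans (labels (aligned-restricts d a₁)) (≋-trans (proj₂ eq) (≋-sym (labels (aligned-restricts d a₂))))

    restricts-size : ∀ {Q H} → Restricts Q H → ∥ Q ∥ ≤ ∥ H ∥
    restricts-size {Q} r =
      ℕ.+-mono-≤ (unique-⊆⇒length-≤ (Γ-unique Q) (edges r))
                 -- Distinct labelled vertices make the prefixed sequents distinct.
                 (unique-⊆⇒length-≤ (AllPairs.map (λ v≢ eq → v≢ (cong proj₁ eq)) (AllPairs.map⁻ (Δ-unique Q)))
                                     (proj₁ (labels r)))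

    eliminated-size : ∀ {H Q} {P : ProofTree 𝔅 H} {P′ : ProofTree 𝔄 Q} (d : Elim P P′)
                      (fresh : Fresh P) (fresh′ : Fresh P′) →
                      ‖ record { tree = P′ ; fresh = fresh′ } ‖ ≤ ‖ record { tree = P ; fresh = fresh } ‖
    eliminated-size {P = P} {P′} d fresh _ = ℕ.*-mono-≤ largest number
      where
      largest : foldr _⊔_ 0 (map ∥_∥ (sequents P′)) ≤ foldr _⊔_ 0 (map ∥_∥ (sequents P))
      largest = foldr-⊔-≤ ∥_∥ (sequents P′) λ Q′∈ → let H′ , a = aligned-target d Q′∈ in
        ℕ.≤-trans (restricts-size (aligned-restricts d a)) (≤-foldr-⊔ ∥_∥ (aligned-source d a))

      number : length (deduplicate _≈?_ (sequents P′)) ≤ length (deduplicate _≈?_ (sequents P))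
      number = length-≤ _≈_ _≈_ (λ Q′ H′ → Aligned d H′ Q′) (aligned-≈ d fresh)
        (λ {x} {y} {z} p q → ≈-trans {y} {x} {z} p (≈-sym {z} {x} q))
        (deduplicate-distinct _≈?_ (sequents P′)) (λ {x} {y} → ≈-sym {x} {y})
        (All.tabulate λ Q′∈ → let H′ , a = aligned-target d (∈-deduplicate⁻ _≈?_ (sequents P′) Q′∈) in
          -- Deduplication may have kept another representative, hence membership up to `≈`.
          H′ , a , Any.deduplicate⁺ _≈?_ (λ {x} {y} p q → ≈-trans {H′} {x} {y} q (≈-sym {y} {x} p))
                     (lose (aligned-source d a) (≈-refl {H′})))

  -- Running the program

  codeEdges : List Edge → Tree
  codeEdges es = codeList (map codeEdge es)

  codeLabels : List Prefixed → Tree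
  codeLabels Δ′ = codeList (map codePrefixed Δ′)

  labelled-code : ∀ {𝔅 H} (P : ProofTree 𝔅 H) {U 1≤U} → Cost.Labelled U 1≤U (codeTree P) (codeLabels (Δ H))
  labelled-code (infer _ _ _) = Cost.labelled

  -- A new edge is copied from the application code, so its size is paid for by code that is not
  -- passed on to the subproofs.
  shape-size : ∀ {app new} → Shape app new → ∀ es → size (codeEdges (new ++ es)) ≤ size app + size (codeEdges es)
  shape-size {app} (plain k) es = ℕ.m≤n+m (size (codeEdges es)) (size app)
  shape-size (expanding {w} {u} {e} {r}) es =
    ℕ.+-monoˡ-≤ (size (codeEdges es))
      (ℕ.≤-trans (s≤s (ℕ.≤-trans (size-left (codeEdge e) r)
                   (ℕ.≤-trans (size-right u (node (codeEdge e) r)) (size-right w (node u (node (codeEdge e) r))))))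
                 (s≤s (ℕ.m≤n+m _ (size (codeℕ 3)))))

  module Run {G : ESystem} {𝔄 𝔅 : Calculus} (N : ℕ) where
    open Elimination G 𝔄 𝔅

    -- One `N` bounds the carried edges plus the remaining proof, the other the labels; 6 covers the
    -- joining nodes and `expandingTag`.
    U : ℕ
    U = 6 + (N + N)

    open Cost U (s≤s z≤n)

    6≤U : 6 ≤ U
    6≤U = ℕ.m≤m+n 6 (N + N)

    input-fits : ∀ γ δ x → size γ + size x ≤ N → size δ ≤ N → Fits (node (node γ δ) x)
    input-fits γ δ x γ+x≤N δ≤N = begin
      3 + ((size γ + size δ) + size x)   ≡⟨ regroup (size γ) (size δ) (size x) ⟩
      3 + ((size γ + size x) + size δ)   ≤⟨ ℕ.+-mono-≤ {3} {6} (ℕ.≤ᵇ⇒≤ 3 6 _) (ℕ.+-mono-≤ γ+x≤N δ≤N) ⟩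
      U                                  ∎
      where
      open ℕ.≤-Reasoning
      regroup : ∀ a b c → 3 + ((a + b) + c) ≡ 3 + ((a + c) + b)
      regroup = solve-∀

    convert-skip : ∀ {app ps p q idx gs y m} → HornShape app → ps ≡ [ p ] →
                   (let x = node idx (node app (node gs (node (codeList ps) leaf)))) → ∀ {γ δ} → q ≡ node γ δ →
                   Fits (node q x) → Returns Convert (node q p) y m → Returns Convert (node q x) y (100 * U + m)
    convert-skip forward  refl refl small r = convert-horn 6≤U small forward-kind r
    convert-skip backward refl refl small r = convert-horn 6≤U small backward-kind r

    convert-keep : ∀ {app new es δ idx gs subs subs′ m} → Shape app new → (let q = node (codeEdges es) δ) →
                   (let x = node idx (node app (node gs (node subs leaf)))) →
                   Fits (node q x) → Returns Converts (node (codeEdges (new ++ es)) subs) subs′ m →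
                   Returns Convert (node q x) (node idx (node app (node q (node subs′ leaf)))) (100 * U + m)
    convert-keep (plain k) small r = convert-plain small (plain-kind k) r
    convert-keep expanding small r = convert-expanding 6≤U small expanding-kind r

    module _ (idx app gs subs : Tree) where
      private x = node idx (node app (node gs (node subs leaf)))

      private
        rest≥ : size app + size subs ≤ size (node app (node gs (node subs leaf)))
        rest≥ = ℕ.m≤n⇒m≤1+n
          (ℕ.+-monoʳ-≤ (size app) (ℕ.≤-trans (size-left subs leaf) (size-right gs (node subs leaf))))

      app+subs≤ : size app + size subs ≤ size x
      app+subs≤ = ℕ.≤-trans rest≥ (size-right idx (node app (node gs (node subs leaf))))

      subs< : size subs < size x
      subs< = s≤s (ℕ.≤-trans (ℕ.≤-trans (ℕ.m≤n+m (size subs) (size app)) rest≥) (ℕ.m≤n+m _ (size idx)))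

      -- The subproofs form a proper subtree of `x`, and the spare unit of size pays for one run of
      -- a body.
      charge : ∀ {k} → k ≤ size subs → 100 * U + k * (100 * U) ≤ size x * (100 * U)
      charge k≤ = ℕ.*-monoˡ-≤ (100 * U) (ℕ.≤-<-trans k≤ subs<)

    -- The bound `N` is on the sum of edges and remaining proof, because this sum does not grow
    -- upwards although the edges do.
    convert : ∀ {H Q} {P : ProofTree 𝔅 H} {P′ : ProofTree 𝔄 Q} → Elim P P′ →
              size (codeEdges (Γ Q)) + size (codeTree P) ≤ N → size (codeLabels (Δ Q)) ≤ N →
              Returns Convert (node (codeGSequent Q) (codeTree P)) (codeTree P′) (size (codeTree P) * (100 * U))
    convert {H} {Q} {P} (skip {σ∈ = σ∈} {α} {ps} i shape single _ d) fitsγ fitsδ =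
      weaken-returns (charge idx app gs subs p≤subs)
        (convert-skip shape single refl (input-fits γ (codeLabels (Δ Q)) (codeTree P) fitsγ fitsδ)
          (convert d (ℕ.≤-trans (ℕ.+-monoʳ-≤ (size γ) p≤) fitsγ) fitsδ))
      where
      γ = codeEdges (Γ Q)
      idx = codeℕ (toℕ (index σ∈))
      app = codeApplication α
      gs = codeGSequent H
      subs = codeList (List.tabulate (λ j → codeTree (ps j)))
      p≤subs = codeList-size (λ j → codeTree (ps j)) i
      p≤ = ℕ.≤-trans p≤subs (ℕ.<⇒≤ (subs< idx app gs subs))
    convert {H} {Q} {P} (keep {σ∈ = σ∈} {ρ∈} {α} {ps} step {qs} same-index _ ds) fitsγ fitsδ =
      subst (λ y → Returns Convert (node (codeGSequent Q) (codeTree P)) y (size (codeTree P) * (100 * U))) output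
        (weaken-returns (charge idx app gs subs ℕ.≤-refl)
          (convert-keep shape (input-fits γ (codeLabels (Δ Q)) (codeTree P) fitsγ fitsδ) children))
      where
      open Step step
      γ = codeEdges (Γ Q)
      γ′ = codeEdges (new ++ Γ Q)
      idx = codeℕ (toℕ (index σ∈))
      app = codeApplication α
      gs = codeGSequent H
      p = λ i → codeTree (ps (source i))
      subs = codeList (List.tabulate (λ j → codeTree (ps j)))
      subs≡ : codeList (List.tabulate p) ≡ subs
      subs≡ = cong codeList (tabulate-subst same-arity (λ j → codeTree (ps j)))
      subs′ = codeList (List.tabulate (λ i → codeTree (qs i)))

      output : node idx (node app (node (codeGSequent Q) (node subs′ leaf))) ≡ codeTree (infer ρ∈ application qs)
      output = cong₂ (λ i a → node i (node a (node (codeGSequent Q) (node subs′ leaf))))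
                 (cong codeℕ (sym same-index)) (sym same-code)

      room : size γ′ + size subs ≤ N
      room = begin
        size γ′ + size subs               ≤⟨ ℕ.+-monoˡ-≤ (size subs) (shape-size shape (Γ Q)) ⟩
        (size app + size γ) + size subs   ≡⟨ cong (_+ size subs) (ℕ.+-comm (size app) (size γ)) ⟩
        (size γ + size app) + size subs   ≡⟨ ℕ.+-assoc (size γ) (size app) (size subs) ⟩
        size γ + (size app + size subs)   ≤⟨ ℕ.+-monoʳ-≤ (size γ) (app+subs≤ idx app gs subs) ⟩
        size γ + size (codeTree P)        ≤⟨ fitsγ ⟩
        N                                 ∎
        where open ℕ.≤-Reasoning

      p-room : ∀ i → size γ′ + size (p i) ≤ N
      p-room i = ℕ.≤-trans (ℕ.+-monoʳ-≤ (size γ′) (codeList-size (λ j → codeTree (ps j)) (source i))) room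

      δ : Fin (arity _) → Tree
      δ i = codeLabels (Δ (lookup premises i))

      child-labelled : ∀ i → Labelled (p i) (δ i)
      child-labelled i = subst (λ Δ′ → Labelled (p i) (codeLabels Δ′)) (sym (premise-labels i))
                           (labelled-code (ps (source i)))

      child : ∀ i → Returns Convert (node (node γ′ (δ i)) (p i)) (codeTree (qs i)) (size (p i) * (100 * U))
      child i = subst (λ es → Returns Convert (node (node (codeEdges es) (δ i)) (p i)) (codeTree (qs i))
                                (size (p i) * (100 * U))) (premise-edges i)
        (convert (ds i)
          (subst (λ es → size (codeEdges es) + size (p i) ≤ N) (sym (premise-edges i)) (p-room i))
          (ℕ.≤-trans (labelled-size (child-labelled i)) (ℕ.≤-trans (ℕ.m≤n+m _ (size γ′)) (p-room i))))

      children : Returns Converts (node γ′ subs) subs′ (size subs * (100 * U))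
      children = subst (λ xs → Returns Converts (node γ′ xs) subs′ (size xs * (100 * U))) subs≡
        (convert-all p δ (λ i → codeTree (qs i)) child-labelled
          (subst (λ xs → Fits (node γ′ xs)) (sym subs≡)
            (ℕ.+-mono-≤ {2} {6} (ℕ.≤ᵇ⇒≤ 2 6 _) (ℕ.≤-trans room (ℕ.m≤m+n N N))))
          child)

  eliminator-polynomial : ∀ {G 𝔄 𝔅 Q} {P : ProofTree 𝔅 Q} {P′ : ProofTree 𝔄 Q} → Elimination.Elim G 𝔄 𝔅 P P′ →
                          eliminator on codeTree P returns codeTree P′ within 2000 * size (codeTree P) ^ 2
  eliminator-polynomial {G} {𝔄} {𝔅} {Q} {P@(infer σ∈ α ps)} d =
    Cost.evaluation (weaken-returns bound (return-main x-fits (convert d fitsγ fitsδ)))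
    where
    x = codeTree P
    s = size x
    -- At the root the edges are a part of `x`, so edges and proof each have size at most `s`.
    open Run {G} {𝔄} {𝔅} (s + s)
    open Cost U (s≤s z≤n)
    gs≤ : size (codeGSequent Q) ≤ s
    gs≤ = size-third (codeℕ (toℕ (index σ∈))) (codeApplication α) (codeGSequent Q)
            (node (codeList (List.tabulate λ i → codeTree (ps i))) leaf)
    fitsγ = ℕ.+-monoˡ-≤ s (ℕ.≤-trans (size-left (codeEdges (Γ Q)) (codeLabels (Δ Q))) gs≤)
    fitsδ = ℕ.≤-trans (ℕ.≤-trans (size-right (codeEdges (Γ Q)) (codeLabels (Δ Q))) gs≤) (ℕ.m≤m+n s s)
    x-fits : Fits x
    x-fits = ℕ.+-mono-≤ {1} {6} (s≤s z≤n) (ℕ.≤-trans (ℕ.m≤m+n s s) (ℕ.m≤m+n (s + s) (s + s)))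
    bound : 100 * U + s * (100 * U) ≤ 2000 * s ^ 2
    bound = begin
      -- As `s` is positive, `suc s` is at most `2s` and `U` at most `10s`; hence the constant 2000.
      suc s * (100 * U)                                  ≤⟨ ℕ.*-mono-≤ (ℕ.+-monoˡ-≤ s (size-positive x)) (ℕ.*-monoʳ-≤ 100 U≤) ⟩
      (s + s) * (100 * (6 * s + ((s + s) + (s + s))))    ≡⟨ regroup s ⟩
      2000 * s ^ 2                                       ∎
      where
      open ℕ.≤-Reasoning
      U≤ : U ≤ 6 * s + ((s + s) + (s + s))
      U≤ = ℕ.+-monoˡ-≤ _ (subst (_≤ 6 * s) (ℕ.*-identityʳ 6) (ℕ.*-monoʳ-≤ 6 (size-positive x)))
      regroup : ∀ s → (s + s) * (100 * (6 * s + ((s + s) + (s + s)))) ≡ 2000 * (s * (s * 1))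
      regroup = solve-∀

mainTheorem15 : (Sig : Signature) → let open Calculi Sig in
    (𝔄 : Calculus) → Implicit 𝔄 →
    (𝔅 : Calculus) → 𝐒 𝔄 𝔅 →
    Σ[ f ∈ (∀ {𝒢} → Proof 𝔅 𝒢 → Proof 𝔄 𝒢) ]
    PolyTime {X = Proof 𝔅} {Y = Proof 𝔄} codeProof codeProof f ×
    (∀ {𝒢} (P : Proof 𝔅 𝒢) → ‖ f P ‖ ≤ ‖ P ‖)
mainTheorem15 Sig 𝔄 implicit 𝔅 below =
  f , (eliminator , 2000 , 2 , λ P → eliminator-polynomial (elim P)) ,
  λ P → eliminated-size (elim P) (fresh P) (fresh (f P))
  where
  open Calculi Sig
  open HornElimination Sig
  open Elimination (Gᶜ 𝔄) 𝔄 𝔅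

  eliminate-root : ∀ {𝒢} (P : ProofTree 𝔅 𝒢) → ∃[ P′ ] Elim {Q = 𝒢} P P′
  eliminate-root P = eliminate (downward-⊵ᶜ 𝔄 implicit below) P
    record { edges = id ; labels = ≋-refl ; covers = λ {_} {x} → ⊆⇒covers {Gᶜ 𝔄} id {x = x} }

  elim : ∀ {𝒢} (P : Proof 𝔅 𝒢) → Elim (tree P) (proj₁ (eliminate-root (tree P)))
  elim P = proj₂ (eliminate-root (tree P))

  f : ∀ {𝒢} → Proof 𝔅 𝒢 → Proof 𝔄 𝒢
  f P = record { tree = proj₁ (eliminate-root (tree P)) ; fresh = eliminated-fresh (elim P) (fresh P) }
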